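{- Let $n$ be a nonnegative integer with $n\equiv 2$ or $n\equiv 3\pmod 4$, and let $F$ be any function from the set of $n$-shapes to $\mathbb{C}$ such that for every $n$-shape $\lambda$, $F(\lambda)=F(\lambda')$, and $I_\lambda=0$ implies $F(\lambda)=0$. Then $$\sum_{\lambda\vdash n}(-1)^{v(\lambda)}F(\lambda)=0.$$
   Context: A shape $\lambda$ is the Ferrers diagram of an integer partition; an $n$-shape ($\lambda\vdash n$) has $n$ squares; $\lambda'$ denotes the conjugate (transposed) shape. A standard Young tableau (SYT) on an $n$-shape is a filling with $1,\ldots,n$, each once, increasing along rows and down columns. The sign $\mathrm{sgn}(T)$ of a tableau is the sign of the word obtained by reading its entries row by row, left to right, top to bottom; the sign of a word of distinct integers is $(-1)^{\#\text{inversions}}$. $I_\lambda=\sum_{T\in\mathrm{SYT}(\lambda)}\mathrm{sgn}(T)$. $v(\lambda)$ is the maximal number of disjoint vertical dominoes ($2\times1$ rectangles) that fit in $\lambda$. -}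

module Defs where

open import Level using (Level)
open import Data.Bool using (Bool; true; false; _∧_; not; T; if_then_else_)
open import Data.Nat using (ℕ; zero; suc; _+_; _<ᵇ_; _≡ᵇ_; _<_)
open import Data.Integer as ℤ using (ℤ; +_)
open import Data.List using (List; []; _∷_; [_]; map; concatMap; length; filter; foldr; zipWith; take; drop; lookup)
open import Data.Bool.ListAction using (and)
open import Data.Nat.ListAction using (sum)
open import Data.Product using (_×_; _,_; Σ; ∃)
open import Data.Sum using (_⊎_)
open import Relation.Binary.PropositionalEquality using (_≡_)
open import Relation.Nullary using (¬_)
open import Data.List.Relation.Unary.All using (All)
open import Data.List.Relation.Unary.AllPairs using (AllPairs)
open import Algebra.Bundles using (CommutativeRing)

nonincr : List ℕ → Bool
nonincr [] = true
nonincr (x ∷ []) = true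
nonincr (x ∷ y ∷ ys) = not (x <ᵇ y) ∧ nonincr (y ∷ ys)

allPositive : List ℕ → Bool
allPositive xs = and (map (λ x → 0 <ᵇ x) xs)

isPartitionOf : ℕ → List ℕ → Bool
isPartitionOf n xs = (sum xs ≡ᵇ n) ∧ (allPositive xs ∧ nonincr xs)

-- an n-shape: its list of row lengths (top row first)
record Shape (n : ℕ) : Set where
  constructor shape
  field
    parts : List ℕ
    valid : T (isPartitionOf n parts)
open Shape public

rowLen : List ℕ → ℕ → ℕ
rowLen [] i = 0
rowLen (x ∷ xs) zero = x
rowLen (x ∷ xs) (suc i) = rowLen xs i

colLen : List ℕ → ℕ → ℕ
colLen xs j = length (filter (λ x → j Data.Nat.<? x) xs)
  where import Data.Nat

conjParts : List ℕ → List ℕ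
conjParts [] = []
conjParts (x ∷ xs) = go x 0
  where
  go : ℕ → ℕ → List ℕ
  go zero j = []
  go (suc k) j = colLen (x ∷ xs) j ∷ go k (suc j)

insertions : ℕ → List ℕ → List (List ℕ)
insertions x [] = [ [ x ] ]
insertions x (y ∷ ys) = (x ∷ y ∷ ys) ∷ map (y ∷_) (insertions x ys)

perms : List ℕ → List (List ℕ)
perms [] = [ [] ]
perms (x ∷ xs) = concatMap (insertions x) (perms xs)

oneTo : ℕ → List ℕ
oneTo zero = []
oneTo (suc n) = oneTo n Data.List.++ [ suc n ]
  where import Data.List

toRows : List ℕ → List ℕ → List (List ℕ)
toRows [] w = []
toRows (r ∷ rs) w = take r w ∷ toRows rs (drop r w)

strictlyIncr : List ℕ → Bool
strictlyIncr [] = true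
strictlyIncr (x ∷ []) = true
strictlyIncr (x ∷ y ∷ ys) = (x <ᵇ y) ∧ strictlyIncr (y ∷ ys)

-- columns increase downward: each entry of a row is below an entry of the
-- previous row (shape is a partition, so the lower row is not longer)
colsIncr : List (List ℕ) → Bool
colsIncr [] = true
colsIncr (r ∷ []) = true
colsIncr (r ∷ s ∷ rs) = and (zipWith _<ᵇ_ r s) ∧ colsIncr (s ∷ rs)

isStandard : List ℕ → List ℕ → Bool
isStandard λs w = and (map strictlyIncr (toRows λs w)) ∧ colsIncr (toRows λs w)

inversions : List ℕ → ℕ
inversions [] = 0
inversions (x ∷ xs) = length (filter (λ y → y Data.Nat.<? x) xs) + inversions xs
  where import Data.Nat

signℤ : ℕ → ℤ
signℤ zero = + 1
signℤ (suc k) = ℤ.- signℤ k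

sgnWord : List ℕ → ℤ
sgnWord w = signℤ (inversions w)

-- I_λ = Σ_{T ∈ SYT(λ)} sgn(T).  A standard Young tableau on an n-shape is
-- determined by its row reading word, a permutation of 1..n; so we sum
-- sgn over all permutations w of 1..n whose row-wise filling is standard.
I : ∀ {n} → Shape n → ℤ
I {n} sh = foldr ℤ._+_ (+ 0)
  (map sgnWord (filter (λ w → Relation.Nullary.Decidable.Core.T? (isStandard (parts sh) w)) (perms (oneTo n))))
  where import Relation.Nullary.Decidable.Core

-- a vertical domino is given by its top cell (i , j) (row i, column j,
-- 0-indexed); it covers (i , j) and (i+1 , j).  It fits in λ iff j < λ_{i+1}.
fitsIn : List ℕ → ℕ × ℕ → Set
fitsIn λs (i , j) = j < rowLen λs (suc i)

disjointDom : ℕ × ℕ → ℕ × ℕ → Set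
disjointDom (i , j) (i' , j') = ¬ (j ≡ j' × (i ≡ i' ⊎ (i ≡ suc i' ⊎ i' ≡ suc i)))

IsDominoPlacement : List ℕ → List (ℕ × ℕ) → Set
IsDominoPlacement λs ds = All (fitsIn λs) ds × AllPairs disjointDom ds

IsMaxVertDominoes : ∀ {n} → Shape n → ℕ → Set
IsMaxVertDominoes sh k =
  (Σ (List (ℕ × ℕ)) λ ds → IsDominoPlacement (parts sh) ds × length ds ≡ k) ×
  (∀ ds → IsDominoPlacement (parts sh) ds → length ds Data.Nat.≤ k)
  where import Data.Nat

module _ {c ℓ : Level} (R : CommutativeRing c ℓ) where
  open CommutativeRing R using (Carrier; 1#; 0#) renaming (-_ to -R_; _+_ to _+R_)

  signR : ℕ → Carrier
  signR zero = 1#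
  signR (suc k) = -R signR k

  sumR : List Carrier → Carrier
  sumR = foldr _+R_ 0#

{-# OPTIONS --safe #-}

-- Colour the cell (i , j) of a diagram black if i + j is odd.  Each vertical domino
-- has exactly one cell in an odd row (rows are numbered from 0), and the dominoes ending in odd rows
-- are disjoint, so v(λ) is the number of cells in odd rows and v(λ') the number of cells in odd
-- columns.  Hence v(λ) + v(λ') has the parity of the number of black cells of λ.
--
-- If two consecutive entries a, a + 1 of a standard tableau lie in cells of the same colour, these
-- cells are not adjacent, so that exchanging the entries gives a standard tableau of opposite sign.
-- Applying this to the pairs (n-1, n), (n-3, n-2), ... cancels everything in I_λ except the tableaux in
-- which each pair has exactly one black cell; if n is odd, the remaining entry 1 lies in the
-- white corner.  So I_λ ≠ 0 forces the number of black cells to be ⌊n/2⌋, which is odd for n ≡ 2, 3 (mod 4).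
-- Thus F(λ) = 0, or v(λ) and v(λ') have different parities; then λ ≠ λ' and the terms of λ and λ' cancel.
module Submission where

open import Defs
open import Level using (Level)
open import Algebra.Bundles using (CommutativeRing)
import Algebra.Properties.CommutativeSemigroup as CommutativeSemigroup
open import Data.Bool using (Bool; true; false; not; _∧_; _xor_; T; if_then_else_)
open import Data.Bool.ListAction using (and)
open import Data.Bool.Properties using (T-∧; T-irrelevant; not-¬; not-involutive; xor-comm; xor-same)
open import Data.Bool.Solver using (module xor-∧-Solver)
open import Data.Empty using (⊥)
open import Data.Integer as ℤ using (ℤ; +_)
import Data.Integer.Properties as ℤ
open import Data.List using (List; []; _∷_; [_]; _++_; map; concat; concatMap; length; filter; foldr; take; drop; zipWith; applyUpTo; upTo)
open import Data.List.Membership.Propositional using (_∈_; _∉_)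
open import Data.List.Membership.Propositional.Properties using (∈-map⁺; ∈-map⁻; ∈-++⁺ˡ; ∈-++⁺ʳ; ∈-∃++; ∈-upTo⁺)
open import Data.List.Properties using (++-assoc; concatMap-++; concatMap-cong; concatMap-map; drop-map; filter-accept; filter-reject; length-++; length-drop; length-map; length-upTo; map-++; map-concatMap; map-cong; map-cong-local; map-id; map-id-local; map-∘; take++drop≡id; take-map; ∷-injective; ∷-injectiveˡ)
open import Data.List.Relation.Binary.Permutation.Propositional using (_↭_; ↭-refl; ↭-sym; ↭-trans; ↭-reflexive; ↭⇒↭ₛ; ↭⇒↭ₛ′; module PermutationReasoning)
import Data.List.Relation.Binary.Permutation.Propositional as ↭
import Data.List.Relation.Binary.Permutation.Propositional.Properties as ↭
open import Data.List.Relation.Binary.Permutation.Setoid.Properties using (foldr-commMonoid; Unique-resp-↭)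
open import Data.List.Relation.Unary.All as All using (All; []; _∷_)
import Data.List.Relation.Unary.All.Properties as All
open import Data.List.Relation.Unary.AllPairs as AllPairs using (AllPairs; []; _∷_)
import Data.List.Relation.Unary.AllPairs.Properties as AllPairs
open import Data.List.Relation.Unary.Any using (here; there)
open import Data.List.Relation.Unary.Unique.Propositional using (Unique)
import Data.List.Relation.Unary.Unique.Propositional.Properties as Unique
open import Data.Nat using (ℕ; zero; suc; _+_; _∸_; _%_; _≤_; _<_; _≥_; _≟_; _<?_; _<ᵇ_; _≡ᵇ_; ⌊_/2⌋; z≤n; s≤s; s≤s⁻¹; z<s)
open import Data.Nat.DivMod using ([m+n]%n≡m%n)
open import Data.Nat.ListAction using (sum)
open import Data.Nat.ListAction.Properties using (sum-++; sum-↭)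
open import Data.Nat.Properties
open import Data.Product using (_×_; _,_; proj₁; proj₂)
open import Data.Sum using (_⊎_; inj₁; inj₂)
open import Function using (_∘_; case_of_)
open import Function.Bundles using (_⇔_; mk⇔; Equivalence)
open import Relation.Binary.PropositionalEquality using (_≡_; _≢_; refl; sym; trans; cong; cong₂; subst; subst₂; setoid; module ≡-Reasoning)
open import Relation.Nullary using (¬_; yes; no; does; contradiction)
open import Relation.Nullary.Decidable using (T?; dec-true; dec-false)

-- Parity and adjacent transpositions

odd : ℕ → Bool
odd zero = false
odd (suc n) = not (odd n)

odd-+ : ∀ m n → odd (m + n) ≡ odd m xor odd n
odd-+ zero n = refl
odd-+ (suc m) n rewrite odd-+ m n with odd m | odd n
... | true  | true  = refl
... | true  | false = refl
... | false | true  = refl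
... | false | false = refl

-- Exchanges a and a + 1.
swap : ℕ → ℕ → ℕ
swap zero    zero          = 1
swap zero    (suc zero)    = 0
swap zero    (suc (suc x)) = suc (suc x)
swap (suc a) zero          = 0
swap (suc a) (suc x)       = suc (swap a x)

swap-involutive : ∀ a x → swap a (swap a x) ≡ x
swap-involutive zero    zero          = refl
swap-involutive zero    (suc zero)    = refl
swap-involutive zero    (suc (suc x)) = refl
swap-involutive (suc a) zero          = refl
swap-involutive (suc a) (suc x)       = cong suc (swap-involutive a x)

swap-injective : ∀ a {x y} → swap a x ≡ swap a y → x ≡ y
swap-injective a {x} {y} e = trans (sym (swap-involutive a x)) (trans (cong (swap a) e) (swap-involutive a y))

swap-lower : ∀ a → swap a a ≡ suc a
swap-lower zero    = refl
swap-lower (suc a) = cong suc (swap-lower a)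

swap-upper : ∀ a → swap a (suc a) ≡ a
swap-upper zero    = refl
swap-upper (suc a) = cong suc (swap-upper a)

swap-fixes : ∀ a {x} → x ≢ a → x ≢ suc a → swap a x ≡ x
swap-fixes zero    {zero}        x≢a x≢1+a = contradiction refl x≢a
swap-fixes zero    {suc zero}    x≢a x≢1+a = contradiction refl x≢1+a
swap-fixes zero    {suc (suc x)} x≢a x≢1+a = refl
swap-fixes (suc a) {zero}        x≢a x≢1+a = refl
swap-fixes (suc a) {suc x}       x≢a x≢1+a = cong suc (swap-fixes a (x≢a ∘ cong suc) (x≢1+a ∘ cong suc))

-- No number lies strictly between `a` and `suc a`, so the exchange affects the comparison of no
-- other pair.
swap-mono-< : ∀ a {x y} → x < y → ¬ (x ≡ a × y ≡ suc a) → swap a x < swap a y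
swap-mono-< zero    {zero}        {suc zero}    x<y ne = contradiction (refl , refl) ne
swap-mono-< zero    {zero}        {suc (suc y)} x<y ne = s≤s (s≤s z≤n)
swap-mono-< zero    {suc zero}    {suc zero}    (s≤s ()) ne
swap-mono-< zero    {suc zero}    {suc (suc y)} x<y ne = s≤s z≤n
swap-mono-< zero    {suc (suc x)} {suc zero}    (s≤s ()) ne
swap-mono-< zero    {suc (suc x)} {suc (suc y)} x<y ne = x<y
swap-mono-< (suc a) {zero}        {suc y}       x<y ne = s≤s z≤n
swap-mono-< (suc a) {suc x}       {suc y}       x<y ne =
  s≤s (swap-mono-< a (s≤s⁻¹ x<y) λ { (refl , refl) → ne (refl , refl) })

map-swap-involutive : ∀ a w → map (swap a) (map (swap a) w) ≡ w
map-swap-involutive a w = trans (sym (map-∘ w)) (trans (map-cong (swap-involutive a) w) (map-id w))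

swap-∉-lower : ∀ {a w} → suc a ∉ w → a ∉ map (swap a) w
swap-∉-lower {a} 1+a∉w a∈ with ∈-map⁻ (swap a) a∈
... | y , y∈w , e = 1+a∉w (subst (_∈ _) (swap-injective a (trans (sym e) (sym (swap-upper a)))) y∈w)

-- Inversions

countBelow : ℕ → List ℕ → ℕ
countBelow x xs = length (filter (_<? x) xs)

countBelow-accept : ∀ {x y} xs → y < x → countBelow x (y ∷ xs) ≡ suc (countBelow x xs)
countBelow-accept {x} xs y<x = cong length (filter-accept (_<? x) y<x)

countBelow-reject : ∀ {x y} xs → ¬ y < x → countBelow x (y ∷ xs) ≡ countBelow x xs
countBelow-reject {x} xs y≮x = cong length (filter-reject (_<? x) y≮x)

countBelow-map : ∀ {f x x'} xs → (∀ {y} → y ∈ xs → (y < x ⇔ f y < x')) →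
                 countBelow x' (map f xs) ≡ countBelow x xs
countBelow-map [] iff = refl
countBelow-map {f} {x} {x'} (y ∷ xs) iff = case y <? x of λ where
    (yes y<x) → trans (countBelow-accept (map f xs) (Equivalence.to (iff (here refl)) y<x))
                  (trans (cong suc ih) (sym (countBelow-accept xs y<x)))
    (no y≮x) → trans (countBelow-reject (map f xs) (y≮x ∘ Equivalence.from (iff (here refl))))
                  (trans ih (sym (countBelow-reject xs y≮x)))
  where
  ih : countBelow x' (map f xs) ≡ countBelow x xs
  ih = countBelow-map xs (iff ∘ there)

inversions-map : ∀ {f} xs → (∀ {y z} → y ∈ xs → z ∈ xs → (y < z ⇔ f y < f z)) →
                 inversions (map f xs) ≡ inversions xs
inversions-map [] iff = refl
inversions-map (x ∷ xs) iff = cong₂ _+_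
  (countBelow-map xs (λ y∈ → iff (there y∈) (here refl)))
  (inversions-map xs (λ y∈ z∈ → iff (there y∈) (there z∈)))

-- The letter `suc a` of `w` becomes `a` and is newly counted. Every other letter is fixed and
-- differs from `a`, so it lies below `suc a` exactly when it lies below `a`. This is the one
-- inversion gained when `a` precedes `suc a`.
countBelow-swap : ∀ {a w} → Unique w → a ∉ w → suc a ∈ w →
                  countBelow (suc a) (map (swap a) w) ≡ suc (countBelow a w)
countBelow-swap {a} {y ∷ w} (y∉w ∷ u) a∉ (here refl) =
  trans (countBelow-accept (map (swap a) w) (≤-reflexive (cong suc (swap-upper a))))
    (cong suc (trans (countBelow-map w λ z∈w → below-⇔ (λ { refl → a∉ (there z∈w) }) (All.lookup y∉w z∈w ∘ sym))
                     (sym (countBelow-reject w (<-asym (n<1+n a))))))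
  where
  below-⇔ : ∀ {z} → z ≢ a → z ≢ suc a → z < a ⇔ swap a z < suc a
  below-⇔ z≢a z≢1+a rewrite swap-fixes a z≢a z≢1+a = mk⇔ m<n⇒m<1+n (λ z<1+a → ≤∧≢⇒< (s≤s⁻¹ z<1+a) z≢a)
countBelow-swap {a} {y ∷ w} (y∉w ∷ u) a∉ (there 1+a∈w) = case y <? a of λ where
    (yes y<a) → trans (countBelow-accept (map (swap a) w) (subst (_< suc a) (sym fixed) (m<n⇒m<1+n y<a)))
                  (cong suc (trans ih (sym (countBelow-accept w y<a))))
    (no y≮a) → trans (countBelow-reject (map (swap a) w)
                       (λ lt → y≮a (≤∧≢⇒< (s≤s⁻¹ (subst (_< suc a) fixed lt)) y≢a)))
                  (trans ih (cong suc (sym (countBelow-reject w y≮a))))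
  where
  y≢a : y ≢ a
  y≢a refl = a∉ (here refl)
  fixed : swap a y ≡ y
  fixed = swap-fixes a y≢a (All.lookup y∉w 1+a∈w)
  ih : countBelow (suc a) (map (swap a) w) ≡ suc (countBelow a w)
  ih = countBelow-swap u (a∉ ∘ there) 1+a∈w

swap-<-⇔ : ∀ a {x y} → ¬ (x ≡ a × y ≡ suc a) → ¬ (x ≡ suc a × y ≡ a) → x < y ⇔ swap a x < swap a y
swap-<-⇔ a {x} {y} ne ne' = mk⇔ (λ x<y → swap-mono-< a x<y ne) λ lt →
  subst₂ _<_ (swap-involutive a x) (swap-involutive a y) (swap-mono-< a lt λ (e , e') →
    ne' (swap-injective a (trans e (sym (swap-upper a))) , swap-injective a (trans e' (sym (swap-lower a)))))

-- The first of the letters `a`, `suc a` in the word gains or loses exactly one inversion with later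
-- letters. Letters before it keep their counts; those after it include only one of the two, so the
-- exchange preserves their order.
odd-inversions-swap : ∀ {a w} → Unique w → a ∈ w → suc a ∈ w →
                      odd (inversions (map (swap a) w)) ≡ not (odd (inversions w))
odd-inversions-swap {a} {x ∷ w} (x∉w ∷ u) a∈ 1+a∈ with x ≟ a | x ≟ suc a
... | yes refl | _ = cong odd (cong₂ _+_
        (trans (cong (λ k → countBelow k (map (swap a) w)) (swap-lower a)) (countBelow-swap u a∉w (tail-∈ 1+a∈)))
        (inversions-map w λ y∈ z∈ → swap-<-⇔ a (λ { (refl , _) → a∉w y∈ }) (λ { (_ , refl) → a∉w z∈ })))
  where
  a∉w : a ∉ w
  a∉w a∈w = All.lookup x∉w a∈w refl
  tail-∈ : suc a ∈ a ∷ w → suc a ∈ w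
  tail-∈ (here e) = contradiction e 1+n≢n
  tail-∈ (there p) = p
-- Here an inversion is lost, so `countBelow-swap` is read backwards: it is applied to the swapped
-- tail, which contains `suc a` but not `a`.
... | no x≢a | yes refl = trans (sym (not-involutive _)) (cong (not ∘ odd) (cong₂ _+_
        (trans (cong suc (cong (λ k → countBelow k (map (swap a) w)) (swap-upper a)))
          (trans (sym (countBelow-swap (Unique.map⁺ (swap-injective a) u) (swap-∉-lower 1+a∉w) 1+a∈σw))
                 (cong (countBelow (suc a)) (map-swap-involutive a w))))
        (inversions-map w λ y∈ z∈ → swap-<-⇔ a (λ { (_ , refl) → 1+a∉w z∈ }) (λ { (refl , _) → 1+a∉w y∈ }))))
  where
  1+a∉w : suc a ∉ w
  1+a∉w p = All.lookup x∉w p refl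
  tail-∈ : a ∈ suc a ∷ w → a ∈ w
  tail-∈ (here e) = contradiction (sym e) 1+n≢n
  tail-∈ (there p) = p
  1+a∈σw : suc a ∈ map (swap a) w
  1+a∈σw = subst (_∈ map (swap a) w) (swap-lower a) (∈-map⁺ (swap a) (tail-∈ a∈))
... | no x≢a | no x≢1+a = begin
  odd (countBelow (swap a x) (map (swap a) w) + inversions (map (swap a) w))
    ≡⟨ odd-+ (countBelow (swap a x) (map (swap a) w)) _ ⟩
  odd (countBelow (swap a x) (map (swap a) w)) xor odd (inversions (map (swap a) w))
    ≡⟨ cong₂ _xor_ (cong odd (countBelow-map w λ _ → swap-<-⇔ a (x≢1+a ∘ proj₂) (x≢a ∘ proj₂)))
                   (odd-inversions-swap u (tail-∈ x≢a a∈) (tail-∈ x≢1+a 1+a∈)) ⟩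
  odd (countBelow x w) xor not (odd (inversions w))
    ≡⟨ xor-not (odd (countBelow x w)) _ ⟩
  not (odd (countBelow x w) xor odd (inversions w))
    ≡⟨ cong not (sym (odd-+ (countBelow x w) _)) ⟩
  not (odd (inversions (x ∷ w))) ∎
  where
  open ≡-Reasoning
  tail-∈ : ∀ {b} → x ≢ b → b ∈ x ∷ w → b ∈ w
  tail-∈ x≢b (here e) = contradiction (sym e) x≢b
  tail-∈ x≢b (there p) = p
  xor-not : ∀ b c → b xor not c ≡ not (b xor c)
  xor-not true  c = refl
  xor-not false c = refl

signℤ-odd : ∀ k → signℤ k ≡ (if odd k then ℤ.-1ℤ else ℤ.1ℤ)
signℤ-odd zero = refl
signℤ-odd (suc k) rewrite signℤ-odd k with odd k
... | true  = refl
... | false = refl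

signℤ-not : ∀ {j k} → odd j ≡ not (odd k) → signℤ j ≡ ℤ.- signℤ k
signℤ-not {j} {k} e rewrite signℤ-odd j | signℤ-odd k | e with odd k
... | true  = refl
... | false = refl

-- Permutations

Σℤ : ∀ {A : Set} → (A → ℤ) → List A → ℤ
Σℤ f xs = foldr ℤ._+_ (+ 0) (map f xs)

Σℤ-↭ : ∀ {A : Set} (f : A → ℤ) {xs ys} → xs ↭ ys → Σℤ f xs ≡ Σℤ f ys
Σℤ-↭ f p = foldr-commMonoid (setoid ℤ) ℤ.+-0-isCommutativeMonoid (↭⇒↭ₛ (↭.map⁺ f p))

concatMap-↭ : ∀ {A B : Set} (f : A → List B) {xs ys} → xs ↭ ys → concatMap f xs ↭ concatMap f ys
concatMap-↭ f ↭.refl = ↭-refl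
concatMap-↭ f (↭.prep x p) = ↭.++⁺ˡ (f x) (concatMap-↭ f p)
concatMap-↭ f (↭.swap x y p) = ↭-trans (↭.++⁺ˡ (f x) (↭.++⁺ˡ (f y) (concatMap-↭ f p))) (↭.shifts (f x) (f y))
concatMap-↭ f (↭.trans p q) = ↭-trans (concatMap-↭ f p) (concatMap-↭ f q)

concatMap-∷-↭ : ∀ {A B : Set} (h : A → B) (f : A → List B) xs →
                concatMap (λ x → h x ∷ f x) xs ↭ map h xs ++ concatMap f xs
concatMap-∷-↭ h f [] = ↭-refl
concatMap-∷-↭ h f (x ∷ xs) = ↭.prep (h x) (↭-trans (↭.++⁺ˡ (f x) (concatMap-∷-↭ h f xs)) (↭.shifts (f x) (map h xs)))

-- The words are grouped by which of `x`, `y` are placed before `z`: both, in two orders; exactly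
-- one; or neither. Exchanging the roles of `x` and `y` permutes the first groups, and the last is
-- the induction hypothesis.
insertions-comm : ∀ x y zs → concatMap (insertions x) (insertions y zs) ↭ concatMap (insertions y) (insertions x zs)
insertions-comm x y [] = ↭.swap (x ∷ y ∷ []) (y ∷ x ∷ []) ↭-refl
insertions-comm x y (z ∷ zs) = begin
  concatMap (insertions x) (insertions y (z ∷ zs))
    ↭⟨ expand x y ⟩
  (x ∷ y ∷ z ∷ zs) ∷ (y ∷ x ∷ z ∷ zs) ∷ (B y x ++ B x y ++ map (z ∷_) (concatMap (insertions x) (insertions y zs)))
    ↭⟨ ↭.swap _ _ (↭-trans (↭.++⁺ˡ (B y x) (↭.++⁺ˡ (B x y) (↭.map⁺ (z ∷_) (insertions-comm x y zs)))) (↭.shifts (B y x) (B x y))) ⟩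
  (y ∷ x ∷ z ∷ zs) ∷ (x ∷ y ∷ z ∷ zs) ∷ (B x y ++ B y x ++ map (z ∷_) (concatMap (insertions y) (insertions x zs)))
    ↭⟨ expand y x ⟨
  concatMap (insertions y) (insertions x (z ∷ zs)) ∎
  where
  open PermutationReasoning
  B : ℕ → ℕ → List (List ℕ)
  B u v = map (λ w → u ∷ z ∷ w) (insertions v zs)
  expand : ∀ x y → concatMap (insertions x) (insertions y (z ∷ zs)) ↭
    (x ∷ y ∷ z ∷ zs) ∷ (y ∷ x ∷ z ∷ zs) ∷ (B y x ++ B x y ++ map (z ∷_) (concatMap (insertions x) (insertions y zs)))
  expand x y = ↭.prep _ (↭.prep _ (↭.++⁺ (↭-reflexive (sym (map-∘ (insertions x zs)))) (begin
    concatMap (insertions x) (map (z ∷_) (insertions y zs))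
      ≡⟨ concatMap-map (insertions x) (z ∷_) (insertions y zs) ⟩
    concatMap (λ w → (x ∷ z ∷ w) ∷ map (z ∷_) (insertions x w)) (insertions y zs)
      ↭⟨ concatMap-∷-↭ _ _ (insertions y zs) ⟩
    B x y ++ concatMap (map (z ∷_) ∘ insertions x) (insertions y zs)
      ≡⟨ cong (B x y ++_) (sym (map-concatMap (z ∷_) (insertions x) (insertions y zs))) ⟩
    B x y ++ map (z ∷_) (concatMap (insertions x) (insertions y zs)) ∎)))

perms-↭ : ∀ {xs ys} → xs ↭ ys → perms xs ↭ perms ys
perms-↭ ↭.refl = ↭-refl
perms-↭ (↭.prep x p) = concatMap-↭ (insertions x) (perms-↭ p)
perms-↭ (↭.swap {xs} {ys} x y p) = begin
  concatMap (insertions x) (concatMap (insertions y) (perms xs))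
    ≡⟨ concatMap-concatMap (insertions x) (insertions y) (perms xs) ⟩
  concatMap (concatMap (insertions x) ∘ insertions y) (perms xs)
    ↭⟨ concatMap-cong-↭ (insertions-comm x y) (perms xs) ⟩
  concatMap (concatMap (insertions y) ∘ insertions x) (perms xs)
    ≡⟨ concatMap-concatMap (insertions y) (insertions x) (perms xs) ⟨
  concatMap (insertions y) (concatMap (insertions x) (perms xs))
    ↭⟨ concatMap-↭ (insertions y) (concatMap-↭ (insertions x) (perms-↭ p)) ⟩
  concatMap (insertions y) (concatMap (insertions x) (perms ys)) ∎
  where
  open PermutationReasoning
  concatMap-concatMap : ∀ {A B C : Set} (f : B → List C) (g : A → List B) xs →
                        concatMap f (concatMap g xs) ≡ concatMap (concatMap f ∘ g) xs
  concatMap-concatMap f g [] = refl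
  concatMap-concatMap f g (x ∷ xs) = trans (concatMap-++ f (g x) _) (cong (concatMap f (g x) ++_) (concatMap-concatMap f g xs))
  concatMap-cong-↭ : ∀ {A B : Set} {f g : A → List B} → (∀ x → f x ↭ g x) → ∀ xs → concatMap f xs ↭ concatMap g xs
  concatMap-cong-↭ e [] = ↭-refl
  concatMap-cong-↭ e (x ∷ xs) = ↭.++⁺ (e x) (concatMap-cong-↭ e xs)
perms-↭ (↭.trans p q) = ↭-trans (perms-↭ p) (perms-↭ q)

map-insertions : ∀ f x ys → map (map f) (insertions x ys) ≡ insertions (f x) (map f ys)
map-insertions f x [] = refl
map-insertions f x (y ∷ ys) = cong ((f x ∷ f y ∷ map f ys) ∷_) (begin
  map (map f) (map (y ∷_) (insertions x ys))   ≡⟨ sym (map-∘ (insertions x ys)) ⟩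
  map (λ w → f y ∷ map f w) (insertions x ys)  ≡⟨ map-∘ (insertions x ys) ⟩
  map (f y ∷_) (map (map f) (insertions x ys)) ≡⟨ cong (map (f y ∷_)) (map-insertions f x ys) ⟩
  map (f y ∷_) (insertions (f x) (map f ys))   ∎)
  where open ≡-Reasoning

map-perms : ∀ f xs → map (map f) (perms xs) ≡ perms (map f xs)
map-perms f [] = refl
map-perms f (x ∷ xs) = begin
  map (map f) (concatMap (insertions x) (perms xs))        ≡⟨ map-concatMap (map f) (insertions x) (perms xs) ⟩
  concatMap (map (map f) ∘ insertions x) (perms xs)        ≡⟨ concatMap-cong (map-insertions f x) (perms xs) ⟩
  concatMap (insertions (f x) ∘ map f) (perms xs)          ≡⟨ concatMap-map (insertions (f x)) (map f) (perms xs) ⟨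
  concatMap (insertions (f x)) (map (map f) (perms xs))    ≡⟨ cong (concatMap (insertions (f x))) (map-perms f xs) ⟩
  concatMap (insertions (f x)) (perms (map f xs))          ∎
  where open ≡-Reasoning

insertions-↭ : ∀ x ys → All (_↭ x ∷ ys) (insertions x ys)
insertions-↭ x [] = ↭-refl ∷ []
insertions-↭ x (y ∷ ys) = ↭-refl ∷ All.map⁺ (All.map (λ p → ↭-trans (↭.prep y p) (↭.swap y x ↭-refl)) (insertions-↭ x ys))

All-perms-↭ : ∀ xs → All (_↭ xs) (perms xs)
All-perms-↭ [] = ↭-refl ∷ []
All-perms-↭ (x ∷ xs) = All.concat⁺ (All.map⁺ (All.map
  (λ {w} p → All.map (λ q → ↭-trans q (↭.prep x p)) (insertions-↭ x w)) (All-perms-↭ xs)))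

∈-oneTo⁺ : ∀ {n x} → 0 < x → x ≤ n → x ∈ oneTo n
∈-oneTo⁺ {zero} 0<x z≤n = contradiction 0<x λ ()
∈-oneTo⁺ {suc n} {x} 0<x x≤n with x ≟ suc n
... | yes refl = ∈-++⁺ʳ (oneTo n) (here refl)
... | no x≢n = ∈-++⁺ˡ (∈-oneTo⁺ 0<x (s≤s⁻¹ (≤∧≢⇒< x≤n x≢n)))

oneTo-bounds : ∀ n → All (λ x → 0 < x × x ≤ n) (oneTo n)
oneTo-bounds zero = []
oneTo-bounds (suc n) = All.++⁺ (All.map (λ (p , q) → p , m≤n⇒m≤1+n q) (oneTo-bounds n)) ((z<s , ≤-refl) ∷ [])

oneTo-unique : ∀ n → Unique (oneTo n)
oneTo-unique zero = []
oneTo-unique (suc n) = Unique.++⁺ (oneTo-unique n) ([] ∷ []) λ { (p , here refl) → 1+n≰n (proj₂ (All.lookup (oneTo-bounds n) p)) }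

length-oneTo : ∀ n → length (oneTo n) ≡ n
length-oneTo zero = refl
length-oneTo (suc n) = trans (length-++ (oneTo n)) (trans (+-comm _ 1) (cong suc (length-oneTo n)))

-- Entries start at 1, so the exchanged pair is `suc a`, `suc (suc a)`. Larger entries are fixed and
-- peeled off the end until the pair stands last, where one transposition restores the order.
map-swap-oneTo : ∀ {a} n → suc (suc a) ≤ n → map (swap (suc a)) (oneTo n) ↭ oneTo n
map-swap-oneTo {a} (suc n) le with suc (suc a) ≟ suc n
... | yes refl = begin
  map (swap (suc a)) ((oneTo a ++ [ suc a ]) ++ [ suc (suc a) ])
    ≡⟨ trans (cong (map (swap (suc a))) (++-assoc (oneTo a) _ _)) (map-++ (swap (suc a)) (oneTo a) _) ⟩
  map (swap (suc a)) (oneTo a) ++ suc (swap a a) ∷ suc (swap a (suc a)) ∷ []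
    ≡⟨ cong₂ _++_ (map-id-local (All.map (λ (_ , x≤a) → swap-fixes (suc a) (<⇒≢ (s≤s x≤a)) (<⇒≢ (m≤n⇒m≤1+n (s≤s x≤a)))) (oneTo-bounds a)))
                  (cong₂ (λ x y → suc x ∷ suc y ∷ []) (swap-lower a) (swap-upper a)) ⟩
  oneTo a ++ suc (suc a) ∷ suc a ∷ []
    ↭⟨ ↭.++⁺ˡ (oneTo a) (↭.swap _ _ ↭-refl) ⟩
  oneTo a ++ suc a ∷ suc (suc a) ∷ []
    ≡⟨ ++-assoc (oneTo a) _ _ ⟨
  (oneTo a ++ [ suc a ]) ++ [ suc (suc a) ] ∎
  where open PermutationReasoning
... | no ne = begin
  map (swap (suc a)) (oneTo n ++ [ suc n ])      ≡⟨ map-++ (swap (suc a)) (oneTo n) _ ⟩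
  map (swap (suc a)) (oneTo n) ++ [ swap (suc a) (suc n) ]
    ≡⟨ cong (λ x → map (swap (suc a)) (oneTo n) ++ [ x ]) (swap-fixes (suc a) (λ { refl → 1+n≰n le }) (ne ∘ sym)) ⟩
  map (swap (suc a)) (oneTo n) ++ [ suc n ]      ↭⟨ ↭.++⁺ʳ _ (map-swap-oneTo n (s≤s⁻¹ (≤∧≢⇒< le ne))) ⟩
  oneTo n ++ [ suc n ] ∎
  where open PermutationReasoning

-- `perms` commutes with relabelling, and reordering the letters only reorders its output. Sums over
-- all words can therefore be reindexed by an exchange.
map-swap-perms : ∀ {a n} → suc (suc a) ≤ n → map (map (swap (suc a))) (perms (oneTo n)) ↭ perms (oneTo n)
map-swap-perms {a} {n} le = ↭-trans (↭-reflexive (map-perms _ (oneTo n))) (perms-↭ (map-swap-oneTo n le))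

-- Checkerboard colourings

altRow : Bool → ℕ → List Bool
altRow b zero    = []
altRow b (suc r) = b ∷ altRow (not b) r

checkerboard : Bool → List ℕ → List (List Bool)
checkerboard b []       = []
checkerboard b (r ∷ rs) = altRow b r ∷ checkerboard (not b) rs

bit : Bool → ℕ
bit true  = 1
bit false = 0

count : List Bool → ℕ
count cs = sum (map bit cs)

-- The number of cells (i , j) with i + j odd.
black : List ℕ → ℕ
black λs = count (concat (checkerboard false λs))

length-altRow : ∀ b r → length (altRow b r) ≡ r
length-altRow b zero = refl
length-altRow b (suc r) = cong suc (length-altRow (not b) r)

length-checkerboard : ∀ b λs → length (concat (checkerboard b λs)) ≡ sum λs
length-checkerboard b [] = refl
length-checkerboard b (r ∷ rs) = trans (length-++ (altRow b r)) (cong₂ _+_ (length-altRow b r) (length-checkerboard (not b) rs))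

-- The colour of the position of a in the word w whose positions are coloured by cs; false if a ∉ w.
colourOf : List Bool → List ℕ → ℕ → Bool
colourOf []       w       a = false
colourOf (c ∷ cs) []      a = false
colourOf (c ∷ cs) (x ∷ w) a = if does (x ≟ a) then c else colourOf cs w a

colourOf-map : ∀ {f} → (∀ {x y} → f x ≡ f y → x ≡ y) → ∀ cs w a →
               colourOf cs (map f w) (f a) ≡ colourOf cs w a
colourOf-map inj [] w a = refl
colourOf-map inj (c ∷ cs) [] a = refl
colourOf-map {f} inj (c ∷ cs) (x ∷ w) a with x ≟ a
... | yes refl rewrite dec-true (f x ≟ f x) refl | dec-true (x ≟ x) refl = refl
... | no x≢a rewrite dec-false (f x ≟ f a) (x≢a ∘ inj) | dec-false (x ≟ a) x≢a = colourOf-map inj cs w a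

-- Without repetitions, the occurrence found by `colourOf` is the only one. The colouring of the
-- cells thus becomes a function of the entries.
map-colourOf : ∀ cs w → length cs ≡ length w → Unique w → map (colourOf cs w) w ≡ cs
map-colourOf [] [] e u = refl
map-colourOf (c ∷ cs) (x ∷ w) e (x∉w ∷ u) = cong₂ _∷_ first rest
  where
  first : colourOf (c ∷ cs) (x ∷ w) x ≡ c
  first rewrite dec-true (x ≟ x) refl = refl
  later : ∀ {y} → x ≢ y → colourOf (c ∷ cs) (x ∷ w) y ≡ colourOf cs w y
  later {y} x≢y rewrite dec-false (x ≟ y) x≢y = refl
  rest : map (colourOf (c ∷ cs) (x ∷ w)) w ≡ cs
  rest = trans (map-cong-local (All.map later x∉w)) (map-colourOf cs w (suc-injective e) u)

toRows-map : ∀ f λs w → toRows λs (map f w) ≡ map (map f) (toRows λs w)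
toRows-map f [] w = refl
toRows-map f (r ∷ rs) w = cong₂ _∷_ (take-map r w) (trans (cong (toRows rs) (drop-map r w)) (toRows-map f rs (drop r w)))

concat-toRows : ∀ λs w → length w ≡ sum λs → concat (toRows λs w) ≡ w
concat-toRows [] [] e = refl
concat-toRows (r ∷ rs) w e = trans (cong (take r w ++_) (concat-toRows rs (drop r w)
  (trans (length-drop r w) (trans (cong (_∸ r) e) (m+n∸m≡n r (sum rs)))))) (take++drop≡id r w)

map-toRows-checkerboard : ∀ (g : ℕ → Bool) b λs w → map g w ≡ concat (checkerboard b λs) →
                          map (map g) (toRows λs w) ≡ checkerboard b λs
map-toRows-checkerboard g b [] w e = refl
map-toRows-checkerboard g b (r ∷ rs) w e = cong₂ _∷_
  (trans (sym (take-map r w)) (trans (cong (take r) e) (take-altRow b r)))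
  (map-toRows-checkerboard g (not b) rs (drop r w) (trans (sym (drop-map r w)) (trans (cong (drop r) e) (drop-altRow b r))))
  where
  take-altRow : ∀ b r {cs} → take r (altRow b r ++ cs) ≡ altRow b r
  take-altRow b zero = refl
  take-altRow b (suc r) = cong (b ∷_) (take-altRow (not b) r)
  drop-altRow : ∀ b r {cs} → drop r (altRow b r ++ cs) ≡ cs
  drop-altRow b zero = refl
  drop-altRow b (suc r) = drop-altRow (not b) r

-- Standard fillings

∧⁻ : ∀ {x y} → T (x ∧ y) → T x × T y
∧⁻ = Equivalence.to T-∧

∧⁺ : ∀ {x y} → T x → T y → T (x ∧ y)
∧⁺ p q = Equivalence.from T-∧ (p , q)

module _ {g : ℕ → Bool} {a : ℕ} (same : g a ≡ g (suc a)) where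

  -- Neighbouring cells have opposite colours, so the entries compared cannot be the equally
  -- coloured `a` and `suc a`.
  swap-<ᵇ : ∀ {b x y} → g x ≡ b → g y ≡ not b → T (x <ᵇ y) → T (swap a x <ᵇ swap a y)
  swap-<ᵇ {x = x} {y} gx gy x<y = <⇒<ᵇ (swap-mono-< a (<ᵇ⇒< x y x<y)
    λ { (refl , refl) → not-¬ refl (trans (sym gx) (trans same gy)) })

  strictlyIncr-swap : ∀ b m r → map g r ≡ altRow b m →
                      T (strictlyIncr r) → T (strictlyIncr (map (swap a) r))
  strictlyIncr-swap b m [] e t = _
  strictlyIncr-swap b m (x ∷ []) e t = _
  strictlyIncr-swap b (suc (suc m)) (x ∷ y ∷ r) e t =
    let x<y , t' = ∧⁻ {x <ᵇ y} t; gx , e' = ∷-injective e in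
    ∧⁺ (swap-<ᵇ gx (∷-injectiveˡ e') x<y) (strictlyIncr-swap (not b) (suc m) (y ∷ r) e' t')

  -- Consecutive rows start with opposite colours, so the cells compared, one above the other, are
  -- of opposite colours as well.
  zip-swap : ∀ b m k r s → map g r ≡ altRow b m → map g s ≡ altRow (not b) k →
             T (and (zipWith _<ᵇ_ r s)) → T (and (zipWith _<ᵇ_ (map (swap a) r) (map (swap a) s)))
  zip-swap b m k [] s er es t = _
  zip-swap b m k (x ∷ r) [] er es t = _
  zip-swap b (suc m) (suc k) (x ∷ r) (y ∷ s) er es t with ∧⁻ {x <ᵇ y} t | ∷-injective er | ∷-injective es
  ... | x<y , t' | gx , er' | gy , es' = ∧⁺ (swap-<ᵇ gx gy x<y) (zip-swap (not b) m k r s er' es' t')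

  rowsIncr-swap : ∀ b λs rows → map (map g) rows ≡ checkerboard b λs →
                  T (and (map strictlyIncr rows)) → T (and (map strictlyIncr (map (map (swap a)) rows)))
  rowsIncr-swap b λs [] e t = _
  rowsIncr-swap b (m ∷ λs) (r ∷ rows) e t with ∧⁻ {strictlyIncr r} t | ∷-injective e
  ... | t₁ , t₂ | e₁ , e₂ = ∧⁺ (strictlyIncr-swap b m r e₁ t₁) (rowsIncr-swap (not b) λs rows e₂ t₂)

  colsIncr-swap : ∀ b λs rows → map (map g) rows ≡ checkerboard b λs →
                  T (colsIncr rows) → T (colsIncr (map (map (swap a)) rows))
  colsIncr-swap b λs [] e t = _
  colsIncr-swap b λs (r ∷ []) e t = _
  colsIncr-swap b (m ∷ k ∷ λs) (r ∷ s ∷ rows) e t =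
    let t₁ , t₂ = ∧⁻ {and (zipWith _<ᵇ_ r s)} t; er , e' = ∷-injective e in
    ∧⁺ (zip-swap b m k r s er (∷-injectiveˡ e') t₁) (colsIncr-swap (not b) (k ∷ λs) (s ∷ rows) e' t₂)

isStandard-swap : ∀ {g a} λs w → map g w ≡ concat (checkerboard false λs) → g a ≡ g (suc a) →
                  T (isStandard λs w) → T (isStandard λs (map (swap a) w))
isStandard-swap {g} {a} λs w e same t rewrite toRows-map (swap a) λs w with ∧⁻ {and (map strictlyIncr (toRows λs w))} t
... | t₁ , t₂ = ∧⁺ (rowsIncr-swap same false λs _ e' t₁) (colsIncr-swap same false λs _ e' t₂)
  where e' = map-toRows-checkerboard g false λs w e

strictlyIncr-head≤ : ∀ x r → T (strictlyIncr (x ∷ r)) → All (x ≤_) (x ∷ r)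
strictlyIncr-head≤ x [] t = ≤-refl ∷ []
strictlyIncr-head≤ x (y ∷ r) t with ∧⁻ {x <ᵇ y} t
... | x<y , t' = ≤-refl ∷ All.map (≤-trans (<⇒≤ (<ᵇ⇒< x y x<y))) (strictlyIncr-head≤ y r t')

-- The heads of the rows increase down the first column, and each head bounds its own row. Positive
-- lengths guarantee that every row has a head.
corner≤ : ∀ x r rows → All ((0 <_) ∘ length) rows → T (and (map strictlyIncr ((x ∷ r) ∷ rows))) →
          T (colsIncr ((x ∷ r) ∷ rows)) → All (x ≤_) (concat ((x ∷ r) ∷ rows))
corner≤ x r [] pos t u = All.++⁺ (strictlyIncr-head≤ x r (proj₁ (∧⁻ {strictlyIncr (x ∷ r)} t))) []
corner≤ x r ((y ∷ s) ∷ rows) (_ ∷ pos) t u with ∧⁻ {strictlyIncr (x ∷ r)} t | ∧⁻ {and (zipWith _<ᵇ_ (x ∷ r) (y ∷ s))} u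
... | t₁ , t₂ | u₁ , u₂ = All.++⁺ (strictlyIncr-head≤ x r t₁)
  (All.map (≤-trans (<⇒≤ (<ᵇ⇒< x y (proj₁ (∧⁻ {x <ᵇ y} u₁))))) (corner≤ y s rows pos t₂ u₂))

-- The corner cell is white and holds the least entry.
colour-of-one : ∀ {g} λs w → All (0 <_) λs → All (0 <_) w → 1 ∈ w → length w ≡ sum λs →
                map g w ≡ concat (checkerboard false λs) → T (isStandard λs w) → g 1 ≡ false
colour-of-one {g} (suc m ∷ λs) (x ∷ w) (_ ∷ λs>0) (x>0 ∷ _) 1∈w len e t with ∧⁻ {and (map strictlyIncr (toRows (suc m ∷ λs) (x ∷ w)))} t
-- The corner entry is at most 1 because 1 occurs in the word, and at least 1 by positivity; so 1
-- has the first colour of the board.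
... | t₁ , t₂ = subst (λ y → g y ≡ false) (≤-antisym (All.lookup x≤ 1∈w) x>0) (∷-injectiveˡ e)
  where
  nonempty : ∀ λs w → All (0 <_) λs → length w ≡ sum λs → All ((0 <_) ∘ length) (toRows λs w)
  nonempty [] w pos len = []
  nonempty (suc r ∷ rs) (y ∷ w) (_ ∷ pos) len = z<s ∷ nonempty rs (drop r w) pos
    (trans (length-drop r w) (trans (cong (_∸ r) (suc-injective len)) (m+n∸m≡n r (sum rs))))
  x≤ : All (x ≤_) (x ∷ w)
  x≤ = subst (All (x ≤_)) (concat-toRows (suc m ∷ λs) (x ∷ w) len)
    (corner≤ x (take m w) (toRows λs (drop m w)) (All.tail (nonempty (suc m ∷ λs) (x ∷ w) (z<s ∷ λs>0) len)) t₁ t₂)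

-- Cancellation of signs

T-ext : ∀ {b c} → (T b → T c) → (T c → T b) → b ≡ c
T-ext {true}  {true}  f g = refl
T-ext {true}  {false} f g = contradiction (f _) λ ()
T-ext {false} {true}  f g = contradiction (g _) λ ()
T-ext {false} {false} f g = refl

Σℤ-cong : ∀ {A : Set} {f g : A → ℤ} {xs} → All (λ x → f x ≡ g x) xs → Σℤ f xs ≡ Σℤ g xs
Σℤ-cong es = cong (foldr ℤ._+_ (+ 0)) (map-cong-local es)

Σℤ-+ : ∀ {A : Set} (f g : A → ℤ) xs → Σℤ (λ x → f x ℤ.+ g x) xs ≡ Σℤ f xs ℤ.+ Σℤ g xs
Σℤ-+ f g [] = refl
Σℤ-+ f g (x ∷ xs) = trans (cong (ℤ._+_ (f x ℤ.+ g x)) (Σℤ-+ f g xs)) (CommutativeSemigroup.interchange ℤ.+-commutativeSemigroup (f x) (g x) (Σℤ f xs) (Σℤ g xs))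

Σℤ-0 : ∀ {A : Set} (xs : List A) → Σℤ (λ _ → + 0) xs ≡ + 0
Σℤ-0 [] = refl
Σℤ-0 (x ∷ xs) = trans (ℤ.+-identityˡ _) (Σℤ-0 xs)

Σℤ-neg : ∀ {A : Set} (f : A → ℤ) xs → Σℤ (λ x → ℤ.- f x) xs ≡ ℤ.- Σℤ f xs
Σℤ-neg f [] = refl
Σℤ-neg f (x ∷ xs) = trans (cong (ℤ._+_ (ℤ.- f x)) (Σℤ-neg f xs)) (sym (ℤ.neg-distrib-+ (f x) _))

i≡-i⇒i≡0 : ∀ {i} → i ≡ ℤ.- i → i ≡ + 0
i≡-i⇒i≡0 {+ zero} e = refl

-- Reindexing along `φ` turns the sum into its own negative, and 0 is the only such integer.
Σℤ-antisymmetric : ∀ {A : Set} (f : A → ℤ) (φ : A → A) {xs} → map φ xs ↭ xs →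
                   All (λ x → f (φ x) ≡ ℤ.- f x) xs → Σℤ f xs ≡ + 0
Σℤ-antisymmetric f φ {xs} p anti = i≡-i⇒i≡0 (begin
  Σℤ f xs               ≡⟨ Σℤ-↭ f p ⟨
  Σℤ f (map φ xs)       ≡⟨ cong (foldr ℤ._+_ (+ 0)) (map-∘ xs) ⟨
  Σℤ (f ∘ φ) xs         ≡⟨ Σℤ-cong anti ⟩
  Σℤ (λ x → ℤ.- f x) xs ≡⟨ Σℤ-neg f xs ⟩
  ℤ.- Σℤ f xs           ∎)
  where open ≡-Reasoning

-- Words outside `p` count as 0 instead of being removed, so that sums for different conditions run
-- over one list and can be split and reindexed there.
restrict : (List ℕ → Bool) → List ℕ → ℤ
restrict p w = if p w then sgnWord w else + 0

Σℤ-filter : ∀ p ws → foldr ℤ._+_ (+ 0) (map sgnWord (filter (λ w → T? (p w)) ws)) ≡ Σℤ (restrict p) ws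
Σℤ-filter p [] = refl
Σℤ-filter p (w ∷ ws) with p w
... | true  = cong (ℤ._+_ (sgnWord w)) (Σℤ-filter p ws)
... | false = trans (Σℤ-filter p ws) (sym (ℤ.+-identityˡ _))

module _ {n : ℕ} (λs : List ℕ) (λs>0 : All (0 <_) λs) (Σλs≡n : sum λs ≡ n) where

  colour : List ℕ → ℕ → Bool
  colour = colourOf (concat (checkerboard false λs))

  differ : ℕ → List ℕ → Bool
  differ a w = colour w a xor colour w (suc a)

  module _ {w} (w↭ : w ↭ oneTo n) where

    word-unique : Unique w
    word-unique = Unique-resp-↭ (setoid ℕ) (↭⇒↭ₛ (↭-sym w↭)) (oneTo-unique n)

    word-∈ : ∀ {x} → 0 < x → x ≤ n → x ∈ w
    word-∈ 0<x x≤n = ↭.∈-resp-↭ (↭-sym w↭) (∈-oneTo⁺ 0<x x≤n)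

    word-length : length w ≡ sum λs
    word-length = trans (↭.↭-length w↭) (trans (length-oneTo n) (sym Σλs≡n))

    map-colour : map (colour w) w ≡ concat (checkerboard false λs)
    map-colour = map-colourOf _ w (trans (length-checkerboard false λs) (sym word-length)) word-unique

    count-colour : count (map (colour w) (oneTo n)) ≡ black λs
    count-colour = trans (sum-↭ (↭.map⁺ bit (↭.map⁺ (colour w) (↭-sym w↭)))) (cong count map-colour)

    map-swap-↭ : ∀ {a} → suc (suc a) ≤ n → map (swap (suc a)) w ↭ oneTo n
    map-swap-↭ le = ↭-trans (↭.map⁺ _ w↭) (map-swap-oneTo n le)

  -- Relabelling an entry does not move it to another cell.
  colour-swap : ∀ a w x → colour (map (swap a) w) (swap a x) ≡ colour w x
  colour-swap a = colourOf-map (swap-injective a) (concat (checkerboard false λs))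

  colour-swap-fixes : ∀ a w {x} → x ≢ a → x ≢ suc a → colour (map (swap a) w) x ≡ colour w x
  colour-swap-fixes a w {x} x≢a x≢1+a =
    trans (cong (colour (map (swap a) w)) (sym (swap-fixes a x≢a x≢1+a))) (colour-swap a w x)

  -- The exchange trades the colours of the two entries, and `xor` is symmetric.
  differ-swap : ∀ a w → differ a (map (swap a) w) ≡ differ a w
  differ-swap a w = trans (cong₂ _xor_
      (trans (cong (colour (map (swap a) w)) (sym (swap-upper a))) (colour-swap a w (suc a)))
      (trans (cong (colour (map (swap a) w)) (sym (swap-lower a))) (colour-swap a w a)))
    (xor-comm (colour w (suc a)) (colour w a))

  count-differ : ∀ (c d : Bool) k → T (c xor d) → k + bit c + bit d ≡ suc k
  count-differ true  false k t = trans (+-identityʳ _) (+-comm k 1)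
  count-differ false true  k t = trans (cong (_+ 1) (+-identityʳ k)) (+-comm k 1)

  xor-false : ∀ {c d} → T (not (c xor d)) → c ≡ d
  xor-false {true}  {true}  t = refl
  xor-false {false} {false} t = refl

  -- The pairs (k-1, k), (k-3, k-2), ... are treated one after the other: words whose entries k-1 and k
  -- have the same colour cancel, in the other words exactly one of these two entries is black.
  cancellation : ∀ k → k ≤ n → (p : List ℕ → Bool) →
    (∀ {w} → w ↭ oneTo n → T (p w) → T (isStandard λs w)) →
    (∀ {a w} → suc (suc a) ≤ k → w ↭ oneTo n → T (not (differ (suc a) w)) → T (p w) → T (p (map (swap (suc a)) w))) →
    (∀ {w} → w ↭ oneTo n → T (p w) → count (map (colour w) (oneTo k)) ≢ ⌊ k /2⌋) →
    Σℤ (restrict p) (perms (oneTo n)) ≡ + 0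
  -- Here `bad` says that an empty count differs from 0, so `p` holds for no word.
  cancellation zero k≤n p std inv bad = trans (Σℤ-cong (All.map vanish (All-perms-↭ (oneTo n)))) (Σℤ-0 (perms (oneTo n)))
    where
    vanish : ∀ {w} → w ↭ oneTo n → restrict p w ≡ + 0
    vanish {w} w↭ with p w | bad w↭
    ... | true  | b = contradiction refl (b _)
    ... | false | _ = refl
  cancellation (suc zero) k≤n p std inv bad = trans (Σℤ-cong (All.map vanish (All-perms-↭ (oneTo n)))) (Σℤ-0 (perms (oneTo n)))
    where
    vanish : ∀ {w} → w ↭ oneTo n → restrict p w ≡ + 0
    vanish {w} w↭ with p w | std w↭ | bad w↭
    ... | false | _ | _ = refl
    -- The remaining entry 1 is white, so the count is 0, which is `⌊ 1 /2⌋`, against `bad`.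
    ... | true  | s | b = contradiction (cong (λ c → bit c + 0) (colour-of-one λs w λs>0
            (↭.All-resp-↭ (↭-sym w↭) (All.map proj₁ (oneTo-bounds n))) (word-∈ w↭ z<s k≤n) (word-length w↭) (map-colour w↭) (s _)))
            (b _)
  cancellation (suc (suc k)) k≤n p std inv bad = begin
    Σℤ (restrict p) W                             ≡⟨ Σℤ-cong {xs = W} (All.universal split W) ⟩
    Σℤ (λ w → restrict q w ℤ.+ restrict r w) W    ≡⟨ Σℤ-+ (restrict q) (restrict r) W ⟩
    Σℤ (restrict q) W ℤ.+ Σℤ (restrict r) W       ≡⟨ cong₂ ℤ._+_ Σq≡0 Σr≡0 ⟩
    + 0 ∎
    where
    open ≡-Reasoning
    W = perms (oneTo n)
    b : ℕ
    b = suc k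
    q r : List ℕ → Bool
    q w = p w ∧ differ b w
    r w = p w ∧ not (differ b w)
    split : ∀ w → restrict p w ≡ restrict q w ℤ.+ restrict r w
    split w with p w | differ b w
    ... | true  | true  = sym (ℤ.+-identityʳ (sgnWord w))
    ... | true  | false = sym (ℤ.+-identityˡ (sgnWord w))
    ... | false | _     = refl
    Σq≡0 : Σℤ (restrict q) W ≡ + 0
    Σq≡0 = cancellation k (≤-trans (n≤1+n k) (≤-trans (n≤1+n (suc k)) k≤n)) q
      (λ {w} w↭ t → std w↭ (proj₁ (∧⁻ {p w} t)))
      -- Exchanges among the entries up to `k` move neither `suc k` nor `suc (suc k)`, so `differ b`
      -- survives them.
      (λ {a} {w} le w↭ same t → let pw , d = ∧⁻ {p w} t in
        ∧⁺ (inv (≤-trans le (≤-trans (n≤1+n k) (n≤1+n (suc k)))) w↭ same pw)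
           (subst T (sym (cong₂ _xor_
              (colour-swap-fixes (suc a) w (<⇒≢ (≤-trans le (n≤1+n k)) ∘ sym) (<⇒≢ (s≤s le) ∘ sym))
              (colour-swap-fixes (suc a) w (<⇒≢ (≤-trans le (≤-trans (n≤1+n k) (n≤1+n (suc k)))) ∘ sym) (<⇒≢ (s≤s (≤-trans le (n≤1+n k))) ∘ sym)))) d))
      -- The pair adds exactly one black entry, and `⌊ suc (suc k) /2⌋` is `suc ⌊ k /2⌋`; a balanced
      -- count up to `k` would thus be balanced up to `suc (suc k)`.
      (λ {w} w↭ t e → let pw , d = ∧⁻ {p w} t in bad w↭ pw (begin
         count (map (colour w) ((oneTo k ++ [ suc k ]) ++ [ suc (suc k) ]))
           ≡⟨ count-∷ʳ (colour w) (oneTo k ++ [ suc k ]) (suc (suc k)) ⟩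
         count (map (colour w) (oneTo k ++ [ suc k ])) + bit (colour w (suc (suc k)))
           ≡⟨ cong (_+ bit (colour w (suc (suc k)))) (count-∷ʳ (colour w) (oneTo k) (suc k)) ⟩
         count (map (colour w) (oneTo k)) + bit (colour w (suc k)) + bit (colour w (suc (suc k)))
           ≡⟨ count-differ (colour w (suc k)) (colour w (suc (suc k))) _ d ⟩
         suc (count (map (colour w) (oneTo k)))
           ≡⟨ cong suc e ⟩
         suc ⌊ k /2⌋ ∎))
      where
      count-∷ʳ : ∀ (g : ℕ → Bool) xs x → count (map g (xs ++ [ x ])) ≡ count (map g xs) + bit (g x)
      count-∷ʳ g [] x = +-identityʳ (bit (g x))
      count-∷ʳ g (y ∷ xs) x = trans (cong (_+_ (bit (g y))) (count-∷ʳ g xs x)) (sym (+-assoc (bit (g y)) _ _))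
    r-swap : ∀ {w} → w ↭ oneTo n → T (r w) → T (r (map (swap b) w))
    r-swap {w} w↭ t = let pw , s = ∧⁻ {p w} t in
      ∧⁺ (inv ≤-refl w↭ s pw) (subst (T ∘ not) (sym (differ-swap b w)) s)
    r-antisymmetric : ∀ {w} → w ↭ oneTo n → restrict r (map (swap b) w) ≡ ℤ.- restrict r w
    r-antisymmetric {w} w↭
      -- The exchange preserves `r` and is its own inverse, so both sides are restricted by the same
      -- truth value and only the signs remain to be compared.
      rewrite T-ext {r (map (swap b) w)} {r w}
                (λ t → subst (T ∘ r) (map-swap-involutive b w) (r-swap (map-swap-↭ w↭ k≤n) t))
                (r-swap w↭)
      with r w
    ... | true  = signℤ-not {inversions (map (swap b) w)} {inversions w}
                    (odd-inversions-swap (word-unique w↭) (word-∈ w↭ z<s (<⇒≤ k≤n)) (word-∈ w↭ z<s k≤n))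
    ... | false = refl
    Σr≡0 : Σℤ (restrict r) W ≡ + 0
    Σr≡0 = Σℤ-antisymmetric (restrict r) (map (swap b)) (map-swap-perms k≤n)
             (All.map r-antisymmetric (All-perms-↭ (oneTo n)))

  Σ-standard≡0 : black λs ≢ ⌊ n /2⌋ → Σℤ (restrict (isStandard λs)) (perms (oneTo n)) ≡ + 0
  Σ-standard≡0 black≢ = cancellation n ≤-refl (isStandard λs) (λ _ t → t)
    (λ {a} {w} _ w↭ same t → isStandard-swap λs w (map-colour w↭) (xor-false same) t)
    -- For `k` equal to `n` the count runs over all entries, hence over all cells.
    (λ w↭ _ e → black≢ (trans (sym (count-colour w↭)) e))

-- Partitions

record Partition (n : ℕ) (λs : List ℕ) : Set where
  constructor partition
  field
    total    : sum λs ≡ n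
    positive : All (0 <_) λs
    sorted   : AllPairs _≥_ λs

allPositive⁻ : ∀ xs → T (allPositive xs) → All (0 <_) xs
allPositive⁻ [] t = []
allPositive⁻ (x ∷ xs) t = let p , q = ∧⁻ {0 <ᵇ x} t in <ᵇ⇒< 0 x p ∷ allPositive⁻ xs q

allPositive⁺ : ∀ {xs} → All (0 <_) xs → T (allPositive xs)
allPositive⁺ [] = _
allPositive⁺ (p ∷ ps) = ∧⁺ (<⇒<ᵇ p) (allPositive⁺ ps)

not-<ᵇ⁻ : ∀ x y → T (not (x <ᵇ y)) → y ≤ x
not-<ᵇ⁻ x y t = ≮⇒≥ λ x<y → lemma (x <ᵇ y) (<⇒<ᵇ x<y) t
  where
  lemma : ∀ b → T b → T (not b) → ⊥
  lemma false () _

not-<ᵇ⁺ : ∀ {x y} → y ≤ x → T (not (x <ᵇ y))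
not-<ᵇ⁺ {x} {y} y≤x = lemma (x <ᵇ y) λ t → ≤⇒≯ y≤x (<ᵇ⇒< x y t)
  where
  lemma : ∀ b → ¬ T b → T (not b)
  lemma true  ¬t = ¬t _
  lemma false ¬t = _

nonincr⁻ : ∀ xs → T (nonincr xs) → AllPairs _≥_ xs
nonincr⁻ [] t = []
nonincr⁻ (x ∷ []) t = [] ∷ []
nonincr⁻ (x ∷ y ∷ ys) t = let p , q = ∧⁻ {not (x <ᵇ y)} t; y≤x = not-<ᵇ⁻ x y p; ih = nonincr⁻ (y ∷ ys) q in
  (y≤x ∷ All.map (λ z≤y → ≤-trans z≤y y≤x) (AllPairs.head ih)) ∷ ih

nonincr⁺ : ∀ {xs} → AllPairs _≥_ xs → T (nonincr xs)
nonincr⁺ [] = _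
nonincr⁺ ([] ∷ []) = _
nonincr⁺ ((y≤x ∷ _) ∷ s@(_ ∷ _)) = ∧⁺ (not-<ᵇ⁺ y≤x) (nonincr⁺ s)

isPartitionOf⁻ : ∀ {n} λs → T (isPartitionOf n λs) → Partition n λs
isPartitionOf⁻ {n} λs t = let p , q = ∧⁻ {sum λs ≡ᵇ n} t; r , s = ∧⁻ {allPositive λs} q in
  partition (≡ᵇ⇒≡ (sum λs) n p) (allPositive⁻ λs r) (nonincr⁻ λs s)

isPartitionOf⁺ : ∀ {n λs} → Partition n λs → T (isPartitionOf n λs)
isPartitionOf⁺ {n} {λs} (partition total positive sorted) =
  ∧⁺ (≡⇒≡ᵇ (sum λs) n total) (∧⁺ (allPositive⁺ positive) (nonincr⁺ sorted))

isPartition : ∀ {n} (sh : Shape n) → Partition n (parts sh)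
isPartition sh = isPartitionOf⁻ (parts sh) (valid sh)

shape-≡ : ∀ {n} {sh sh' : Shape n} → parts sh ≡ parts sh' → sh ≡ sh'
shape-≡ {sh = shape p v} {shape .p v'} refl = cong (shape p) (T-irrelevant v v')

-- Cells in odd rows, odd columns and black cells

-- The total length of the rows coloured true, when the colours of the rows alternate starting from b.
oddRows : Bool → List ℕ → ℕ
oddRows b     []       = 0
oddRows true  (r ∷ rs) = r + oddRows false rs
oddRows false (r ∷ rs) = oddRows true rs

-- For a row of length `r`, `half false r` is the number of cells in odd columns, r/2 rounded down;
-- `half true r` is the number in even columns, r/2 rounded up.
half : Bool → ℕ → ℕ
half b r = count (altRow b r)

halves : Bool → List ℕ → ℕ
halves b λs = sum (map (half b) λs)

half-true+half-false : ∀ r → half true r + half false r ≡ r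
half-true+half-false zero = refl
half-true+half-false (suc r) = cong suc (trans (+-comm (half false r) _) (half-true+half-false r))

halves-true+halves-false : ∀ λs → halves true λs + halves false λs ≡ sum λs
halves-true+halves-false [] = refl
halves-true+halves-false (r ∷ rs) = trans (CommutativeSemigroup.interchange +-commutativeSemigroup (half true r) (halves true rs) (half false r) (halves false rs))
    (cong₂ _+_ (half-true+half-false r) (halves-true+halves-false rs))

oddRows-true+oddRows-false : ∀ λs → oddRows true λs + oddRows false λs ≡ sum λs
oddRows-true+oddRows-false [] = refl
oddRows-true+oddRows-false (r ∷ rs) = trans (+-assoc r _ _)
  (cong (_+_ r) (trans (+-comm (oddRows false rs) _) (oddRows-true+oddRows-false rs)))

-- Modulo 2, row by row: a row starting white has `half false r` black cells; a row starting black
-- has `half true r`, which is congruent to `r + half false r`, and the `r` is collected by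
-- `oddRows`.
odd-count-checkerboard : ∀ b λs → odd (count (concat (checkerboard b λs))) ≡ odd (oddRows b λs) xor odd (halves false λs)
odd-count-checkerboard b [] = refl
odd-count-checkerboard b (r ∷ rs) = trans (begin
  odd (count (altRow b r ++ concat (checkerboard (not b) rs)))
    ≡⟨ cong odd (trans (cong sum (map-++ bit (altRow b r) _)) (sum-++ (map bit (altRow b r)) _)) ⟩
  odd (half b r + count (concat (checkerboard (not b) rs)))
    ≡⟨ odd-+ (half b r) _ ⟩
  odd (half b r) xor odd (count (concat (checkerboard (not b) rs)))
    ≡⟨ cong (odd (half b r) xor_) (odd-count-checkerboard (not b) rs) ⟩
  odd (half b r) xor (odd (oddRows (not b) rs) xor odd (halves false rs)) ∎) (regroup b)
  where
  open ≡-Reasoning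
  open xor-∧-Solver
  regroup : ∀ b → odd (half b r) xor (odd (oddRows (not b) rs) xor odd (halves false rs)) ≡
                  odd (oddRows b (r ∷ rs)) xor odd (half false r + halves false rs)
  regroup false = trans
    (solve 3 (λ f x h → f :+ (x :+ h) := x :+ (f :+ h)) refl (odd (half false r)) (odd (oddRows true rs)) (odd (halves false rs)))
    (cong (odd (oddRows true rs) xor_) (sym (odd-+ (half false r) _)))
  regroup true = trans
    (solve 4 (λ t f x h → t :+ (x :+ h) := ((t :+ f) :+ x) :+ (f :+ h)) refl
      (odd (half true r)) (odd (half false r)) (odd (oddRows false rs)) (odd (halves false rs)))
    (cong₂ _xor_
      (sym (trans (odd-+ r _) (cong (_xor odd (oddRows false rs))
        (trans (cong odd (sym (half-true+half-false r))) (odd-+ (half true r) _)))))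
      (sym (odd-+ (half false r) _)))

-- Maximal vertical domino packings

topCell : ℕ → ℕ × ℕ
topCell j = 0 , j

shiftRows : ℕ × ℕ → ℕ × ℕ
shiftRows (i , j) = suc (suc i) , j

-- An optimal packing: each cell of an odd row is the lower cell of a domino whose top lies in the
-- even row above.
dominoes : List ℕ → List (ℕ × ℕ)
dominoes []           = []
dominoes (x ∷ [])     = []
dominoes (x ∷ y ∷ rs) = map topCell (upTo y) ++ map shiftRows (dominoes rs)

length-dominoes : ∀ λs → length (dominoes λs) ≡ oddRows false λs
length-dominoes [] = refl
length-dominoes (x ∷ []) = refl
length-dominoes (x ∷ y ∷ rs) = trans (length-++ (map topCell (upTo y))) (cong₂ _+_
  (trans (length-map topCell (upTo y)) (length-upTo y))
  (trans (length-map shiftRows (dominoes rs)) (length-dominoes rs)))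

dominoes-fit : ∀ λs → All (fitsIn λs) (dominoes λs)
dominoes-fit [] = []
dominoes-fit (x ∷ []) = []
dominoes-fit (x ∷ y ∷ rs) = All.++⁺ (All.map⁺ (All.all-upTo y)) (All.map⁺ (dominoes-fit rs))

dominoes-disjoint : ∀ λs → AllPairs disjointDom (dominoes λs)
dominoes-disjoint [] = []
dominoes-disjoint (x ∷ []) = []
dominoes-disjoint (x ∷ y ∷ rs) = AllPairs.++⁺
  (AllPairs.map⁺ (AllPairs.map (λ j≢j' → j≢j' ∘ proj₁) (Unique.upTo⁺ y)))
  (AllPairs.map⁺ (AllPairs.map shifted (dominoes-disjoint rs)))
  (All.map⁺ (All.universal (λ _ → All.map⁺ (All.universal separated (dominoes rs))) (upTo y)))
  where
  shifted : ∀ {d e} → disjointDom d e → disjointDom (shiftRows d) (shiftRows e)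
  shifted ne (refl , inj₁ refl) = ne (refl , inj₁ refl)
  shifted ne (refl , inj₂ (inj₁ refl)) = ne (refl , inj₂ (inj₁ refl))
  shifted ne (refl , inj₂ (inj₂ refl)) = ne (refl , inj₂ (inj₂ refl))
  separated : ∀ {j} e → disjointDom (0 , j) (shiftRows e)
  separated e (_ , inj₂ (inj₁ ()))
  separated e (_ , inj₂ (inj₂ ()))

-- The largest even number not above the argument, in steps of two to match the recursion of
-- `dominoes`.
roundDown : ℕ → ℕ
roundDown zero          = 0
roundDown (suc zero)    = 0
roundDown (suc (suc i)) = suc (suc (roundDown i))

-- The fibres are the pairs 2m, 2m + 1. The conclusion is the condition on rows that `disjointDom`
-- negates.
roundDown-≡ : ∀ i i' → roundDown i ≡ roundDown i' → i ≡ i' ⊎ (i ≡ suc i' ⊎ i' ≡ suc i)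
roundDown-≡ zero zero e = inj₁ refl
roundDown-≡ zero (suc zero) e = inj₂ (inj₂ refl)
roundDown-≡ (suc zero) zero e = inj₂ (inj₁ refl)
roundDown-≡ (suc zero) (suc zero) e = inj₁ refl
roundDown-≡ (suc (suc i)) (suc (suc i')) e with roundDown-≡ i i' (suc-injective (suc-injective e))
... | inj₁ p = inj₁ (cong (suc ∘ suc) p)
... | inj₂ (inj₁ p) = inj₂ (inj₁ (cong (suc ∘ suc) p))
... | inj₂ (inj₂ p) = inj₂ (inj₂ (cong (suc ∘ suc) p))

alignDown : ℕ × ℕ → ℕ × ℕ
alignDown (i , j) = roundDown i , j

alignDown-∈-dominoes : ∀ {λs} → AllPairs _≥_ λs → ∀ i {j} → j < rowLen λs (suc i) →
                       (roundDown i , j) ∈ dominoes λs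
alignDown-∈-dominoes {x ∷ y ∷ rs} s zero j<y = ∈-++⁺ˡ (∈-map⁺ topCell (∈-upTo⁺ j<y))
-- A domino on rows 1 and 2 moves up to rows 0 and 1; it still fits because row 2 is no longer than
-- row 1.
alignDown-∈-dominoes {x ∷ y ∷ z ∷ rs} (_ ∷ (z≤y ∷ _) ∷ _) (suc zero) j<z =
  ∈-++⁺ˡ (∈-map⁺ topCell (∈-upTo⁺ (≤-trans j<z z≤y)))
alignDown-∈-dominoes {x ∷ y ∷ rs} (_ ∷ _ ∷ s) (suc (suc i)) j< =
  ∈-++⁺ʳ (map topCell (upTo y)) (∈-map⁺ shiftRows (alignDown-∈-dominoes s i j<))

Unique-⊆⇒length-≤ : ∀ {A : Set} {xs ys : List A} → Unique xs → All (_∈ ys) xs → length xs ≤ length ys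
Unique-⊆⇒length-≤ [] [] = z≤n
Unique-⊆⇒length-≤ {A} {x ∷ xs} {ys} (x∉xs ∷ u) (x∈ys ∷ xs⊆ys) with ∈-∃++ x∈ys
... | as , bs , refl = ≤-trans (s≤s (Unique-⊆⇒length-≤ u (All.zipWith remove (x∉xs , xs⊆ys))))
                               (≤-reflexive (sym (↭.↭-length (↭.shift x as bs))))
  where
  remove : ∀ {z} → x ≢ z × z ∈ as ++ x ∷ bs → z ∈ as ++ bs
  remove (x≢z , z∈) with ↭.∈-resp-↭ (↭.shift x as bs) z∈
  ... | here z≡x = contradiction (sym z≡x) x≢z
  ... | there p  = p

-- Moving each domino up, if necessary, to start in an even row keeps distinct dominoes distinct.
domino-bound : ∀ {λs} → AllPairs _≥_ λs → ∀ ds → IsDominoPlacement λs ds → length ds ≤ oddRows false λs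
domino-bound {λs} s ds (fit , disjoint) = begin
  length ds                 ≡⟨ length-map alignDown ds ⟨
  length (map alignDown ds) ≤⟨ Unique-⊆⇒length-≤
    (AllPairs.map⁺ (AllPairs.map distinct disjoint)) (All.map⁺ (All.map (λ {d} → alignDown-∈-dominoes s (proj₁ d)) fit)) ⟩
  length (dominoes λs)      ≡⟨ length-dominoes λs ⟩
  oddRows false λs          ∎
  where
  open ≤-Reasoning
  distinct : ∀ {d e} → disjointDom d e → alignDown d ≢ alignDown e
  distinct {i , j} {i' , j'} ne e = ne (cong proj₂ e , roundDown-≡ i i' (cong proj₁ e))

v≡oddRows : ∀ {n} (sh : Shape n) {k} → IsMaxVertDominoes sh k → k ≡ oddRows false (parts sh)
v≡oddRows sh ((ds , placed , refl) , maximal) = ≤-antisym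
  (domino-bound (Partition.sorted (isPartition sh)) ds placed)
  (subst (_≤ length ds) (length-dominoes (parts sh))
    (maximal (dominoes (parts sh)) (dominoes-fit (parts sh) , dominoes-disjoint (parts sh))))

-- Conjugation

-- The local function go of conjParts cannot be named here.  The type of go≡R mentions it as `_`, which
-- the call in tail-conjParts determines by unification, after its arguments are abstracted to variables.
module _ (R : ℕ → List ℕ → ℕ → ℕ → List ℕ)
         (R-zero : ∀ x xs j → R x xs 0 j ≡ [])
         (R-suc : ∀ x xs k j → R x xs (suc k) j ≡ colLen (x ∷ xs) j ∷ R x xs k (suc j)) where

  go≡R : ∀ x xs k j → _ ≡ R x xs k j

  tail-conjParts : ∀ k xs → drop 1 (conjParts (suc k ∷ xs)) ≡ R (suc k) xs k 1
  tail-conjParts k xs with suc k | 1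
  ... | x | j = go≡R x xs k j

  go≡R x xs zero j = sym (R-zero x xs j)
  go≡R x xs (suc k) j = trans (cong (colLen (x ∷ xs) j ∷_) (go≡R x xs k (suc j))) (sym (R-suc x xs k j))

conjParts-applyUpTo : ∀ x xs → conjParts (x ∷ xs) ≡ applyUpTo (colLen (x ∷ xs)) x
conjParts-applyUpTo zero xs = refl
conjParts-applyUpTo (suc x) xs = cong (colLen (suc x ∷ xs) 0 ∷_) (tail-conjParts
  -- The local function with arguments `k` and `j` lists the `k` columns starting at column `j`.
  (λ x xs k j → applyUpTo (λ i → colLen (x ∷ xs) (j + i)) k) (λ _ _ _ → refl)
  (λ x xs k j → cong₂ _∷_ (cong (colLen (x ∷ xs)) (+-identityʳ j)) (applyUpTo-cong k λ i → cong (colLen (x ∷ xs)) (+-suc j i)))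
  x xs)
  where
  applyUpTo-cong : ∀ {f g : ℕ → ℕ} k → (∀ i → f i ≡ g i) → applyUpTo f k ≡ applyUpTo g k
  applyUpTo-cong zero e = refl
  applyUpTo-cong (suc k) e = cong₂ _∷_ (e 0) (applyUpTo-cong k (e ∘ suc))

colLen-accept : ∀ {x j} xs → j < x → colLen (x ∷ xs) j ≡ suc (colLen xs j)
colLen-accept {j = j} xs j<x = cong length (filter-accept (λ y → j <? y) {xs = xs} j<x)

colLen-reject : ∀ {x j} xs → ¬ j < x → colLen (x ∷ xs) j ≡ colLen xs j
colLen-reject {j = j} xs j≮x = cong length (filter-reject (λ y → j <? y) {xs = xs} j≮x)

-- The indicator form makes column lengths additive over the rows, as `oddRows-colLen` requires.
colLen-∷ : ∀ x xs j → colLen (x ∷ xs) j ≡ bit (j <ᵇ x) + colLen xs j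
colLen-∷ x xs j with j <ᵇ x
... | true  = refl
... | false = refl

colLen-≥ : ∀ {x j xs} → All (_≤ x) xs → x ≤ j → colLen xs j ≡ 0
colLen-≥ [] x≤j = refl
colLen-≥ {xs = y ∷ ys} (y≤x ∷ ys≤x) x≤j =
  trans (colLen-reject ys (≤⇒≯ (≤-trans y≤x x≤j))) (colLen-≥ ys≤x x≤j)

colLen-antitone : ∀ xs {i j} → i ≤ j → colLen xs j ≤ colLen xs i
colLen-antitone [] i≤j = z≤n
colLen-antitone (x ∷ xs) {i} {j} i≤j = case (j <? x) of λ where
  (yes j<x) → subst₂ _≤_ (sym (colLen-accept xs j<x)) (sym (colLen-accept xs (≤-<-trans i≤j j<x)))
                (s≤s (colLen-antitone xs i≤j))
  (no j≮x) → subst₂ _≤_ (sym (colLen-reject xs j≮x)) (sym (colLen-∷ x xs i))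
                (≤-trans (colLen-antitone xs i≤j) (m≤n+m _ _))

-- Past the end `rowLen` takes the default 0, which `f` must match from `x` on.
rowLen-applyUpTo : ∀ f x → (∀ {j} → x ≤ j → f j ≡ 0) → ∀ j → rowLen (applyUpTo f x) j ≡ f j
rowLen-applyUpTo f zero f≡0 j = sym (f≡0 z≤n)
rowLen-applyUpTo f (suc x) f≡0 zero = refl
rowLen-applyUpTo f (suc x) f≡0 (suc j) = rowLen-applyUpTo (f ∘ suc) x (f≡0 ∘ s≤s) j

rowLen-conjParts : ∀ {λs} → AllPairs _≥_ λs → ∀ j → rowLen (conjParts λs) j ≡ colLen λs j
rowLen-conjParts [] j = refl
rowLen-conjParts {x ∷ xs} (xs≤x ∷ s) j rewrite conjParts-applyUpTo x xs =
  rowLen-applyUpTo (colLen (x ∷ xs)) x (colLen-≥ (≤-refl ∷ xs≤x)) j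

-- Both sides say that the cell (i , j) lies in the diagram.
<rowLen⇔<colLen : ∀ {λs} → AllPairs _≥_ λs → ∀ i j → j < rowLen λs i ⇔ i < colLen λs j
<rowLen⇔<colLen [] i j = mk⇔ (λ ()) (λ ())
<rowLen⇔<colLen {x ∷ xs} (xs≤x ∷ s) i j = case (j <? x) of λ where
    (yes j<x) → subst (λ c → j < rowLen (x ∷ xs) i ⇔ i < c) (sym (colLen-accept xs j<x)) (inside i j<x)
    (no j≮x) → subst (λ c → j < rowLen (x ∷ xs) i ⇔ i < c)
                 (sym (trans (colLen-reject xs j≮x) (colLen-≥ xs≤x (≮⇒≥ j≮x))))
                 (mk⇔ (λ j< → contradiction (≤-trans j< (rowLen≤ (≤-refl ∷ xs≤x) i)) j≮x) (λ ()))
  where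
  rowLen≤ : ∀ {ys} → All (_≤ x) ys → ∀ i → rowLen ys i ≤ x
  rowLen≤ [] i = z≤n
  rowLen≤ (y≤x ∷ ys≤x) zero = y≤x
  rowLen≤ (y≤x ∷ ys≤x) (suc i) = rowLen≤ ys≤x i
  inside : ∀ i → j < x → j < rowLen (x ∷ xs) i ⇔ i < suc (colLen xs j)
  inside zero j<x = mk⇔ (λ _ → z<s) (λ _ → j<x)
  inside (suc i) j<x = mk⇔ (s≤s ∘ Equivalence.to (<rowLen⇔<colLen s i j)) (Equivalence.from (<rowLen⇔<colLen s i j) ∘ s≤s⁻¹)

-- `rowLen` cannot see trailing zeros; positivity excludes them.
rowLen-extensional : ∀ {λs μs} → All (0 <_) λs → All (0 <_) μs → (∀ i → rowLen λs i ≡ rowLen μs i) → λs ≡ μs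
rowLen-extensional [] [] e = refl
rowLen-extensional [] (y>0 ∷ _) e = contradiction (e 0) (<⇒≢ y>0)
rowLen-extensional (x>0 ∷ _) [] e = contradiction (sym (e 0)) (<⇒≢ x>0)
rowLen-extensional (_ ∷ p) (_ ∷ q) e = cong₂ _∷_ (e 0) (rowLen-extensional p q (e ∘ suc))

-- Double counting: `oddRows` is additive, and a row of length `y` contributes 1 to each of the
-- first `y` columns, `half b y` in total. As `x` only bounds the row lengths, it stays fixed while
-- rows are removed.
oddRows-colLen : ∀ b x {λs} → All (_≤ x) λs → oddRows b (applyUpTo (colLen λs) x) ≡ halves b λs
oddRows-colLen b x [] = oddRows-zero b x
  where
  oddRows-zero : ∀ b x → oddRows b (applyUpTo (λ _ → 0) x) ≡ 0
  oddRows-zero b zero = refl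
  oddRows-zero true (suc x) = oddRows-zero false x
  oddRows-zero false (suc x) = oddRows-zero true x
oddRows-colLen b x {y ∷ ys} (y≤x ∷ ys≤x) = begin
  oddRows b (applyUpTo (colLen (y ∷ ys)) x)
    ≡⟨ oddRows-+ b x (λ j → bit (j <ᵇ y)) (colLen ys) (colLen-∷ y ys) ⟩
  oddRows b (applyUpTo (λ j → bit (j <ᵇ y)) x) + oddRows b (applyUpTo (colLen ys) x)
    ≡⟨ cong₂ _+_ (oddRows-bit b x y y≤x) (oddRows-colLen b x ys≤x) ⟩
  half b y + halves b ys ∎
  where
  open ≡-Reasoning
  oddRows-+ : ∀ b x {h : ℕ → ℕ} f g → (∀ j → h j ≡ f j + g j) →
              oddRows b (applyUpTo h x) ≡ oddRows b (applyUpTo f x) + oddRows b (applyUpTo g x)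
  oddRows-+ b zero f g e = refl
  oddRows-+ true (suc x) f g e = trans (cong₂ _+_ (e 0) (oddRows-+ false x (f ∘ suc) (g ∘ suc) (e ∘ suc)))
    (CommutativeSemigroup.interchange +-commutativeSemigroup (f 0) (g 0) _ _)
  oddRows-+ false (suc x) f g e = oddRows-+ true x (f ∘ suc) (g ∘ suc) (e ∘ suc)
  oddRows-bit : ∀ b x y → y ≤ x → oddRows b (applyUpTo (λ j → bit (j <ᵇ y)) x) ≡ half b y
  oddRows-bit b zero zero le = refl
  oddRows-bit true (suc x) zero le = oddRows-bit false x zero z≤n
  oddRows-bit false (suc x) zero le = oddRows-bit true x zero z≤n
  oddRows-bit true (suc x) (suc y) le = cong suc (oddRows-bit false x y (s≤s⁻¹ le))
  oddRows-bit false (suc x) (suc y) le = oddRows-bit true x y (s≤s⁻¹ le)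

oddRows-conjParts : ∀ b {λs} → AllPairs _≥_ λs → oddRows b (conjParts λs) ≡ halves b λs
oddRows-conjParts b [] = refl
oddRows-conjParts b {x ∷ xs} (xs≤x ∷ s) rewrite conjParts-applyUpTo x xs = oddRows-colLen b x (≤-refl ∷ xs≤x)

conjParts-partition : ∀ {n λs} → Partition n λs → Partition n (conjParts λs)
conjParts-partition {n} {λs} (partition total positive sorted) = partition
    -- The size is split by row parity in the conjugate and by column parity in `λs`; the parts
    -- agree.
    (trans (sym (oddRows-true+oddRows-false (conjParts λs)))
      (trans (cong₂ _+_ (oddRows-conjParts true sorted) (oddRows-conjParts false sorted))
        (trans (halves-true+halves-false λs) total)))
    (conj-positive λs) (conj-sorted λs)
  where
  conj-positive : ∀ λs → All (0 <_) (conjParts λs)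
  conj-positive [] = []
  conj-positive (x ∷ xs) rewrite conjParts-applyUpTo x xs =
    All.applyUpTo⁺₁ (colLen (x ∷ xs)) x λ j<x → subst (0 <_) (sym (colLen-accept xs j<x)) z<s
  conj-sorted : ∀ λs → AllPairs _≥_ (conjParts λs)
  conj-sorted [] = []
  conj-sorted (x ∷ xs) rewrite conjParts-applyUpTo x xs =
    AllPairs.applyUpTo⁺₁ (colLen (x ∷ xs)) x λ i<j _ → colLen-antitone (x ∷ xs) (<⇒≤ i<j)

conj : ∀ {n} → Shape n → Shape n
conj sh = shape (conjParts (parts sh)) (isPartitionOf⁺ (conjParts-partition (isPartition sh)))

-- Row `i` of the double conjugate is column `i` of the conjugate. Membership of cells, transposed
-- twice, shows that the same numbers `j` lie below this length and below the length of row `i` of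
-- the shape.
conj-involutive : ∀ {n} (sh : Shape n) → conj (conj sh) ≡ sh
conj-involutive sh = shape-≡ (rowLen-extensional (positive (isPartition (conj (conj sh)))) (positive p) λ i →
    trans (rowLen-conjParts (sorted p') i) (≤-antisym (below i) (above i)))
  where
  open Partition
  p = isPartition sh
  p' = isPartition (conj sh)
  λs = parts sh
  below-≤ : ∀ {m k} → (∀ {j} → j < m → j < k) → m ≤ k
  below-≤ {zero} f = z≤n
  below-≤ {suc m} f = f ≤-refl
  below : ∀ i → colLen (conjParts λs) i ≤ rowLen λs i
  below i = below-≤ λ {j} j< → Equivalence.from (<rowLen⇔<colLen (sorted p) i j)
    (subst (i <_) (rowLen-conjParts (sorted p) j) (Equivalence.from (<rowLen⇔<colLen (sorted p') j i) j<))
  above : ∀ i → rowLen λs i ≤ colLen (conjParts λs) i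
  above i = below-≤ λ {j} j< → Equivalence.to (<rowLen⇔<colLen (sorted p') j i)
    (subst (i <_) (sym (rowLen-conjParts (sorted p) j)) (Equivalence.to (<rowLen⇔<colLen (sorted p) i j) j<))

-- Parity of v on conjugate shapes and vanishing of I

odd-v-xor-odd-v-conj : ∀ {n} (v : Shape n → ℕ) → (∀ sh → IsMaxVertDominoes sh (v sh)) →
                       ∀ sh → odd (v sh) xor odd (v (conj sh)) ≡ odd (black (parts sh))
odd-v-xor-odd-v-conj v vmax sh = trans
  (cong₂ (λ x y → odd x xor odd y) (v≡oddRows sh (vmax sh))
    (trans (v≡oddRows (conj sh) (vmax (conj sh))) (oddRows-conjParts false (Partition.sorted (isPartition sh)))))
  (sym (odd-count-checkerboard false (parts sh)))

odd-⌊n/2⌋ : ∀ n → (n % 4 ≡ 2 ⊎ n % 4 ≡ 3) → odd ⌊ n /2⌋ ≡ true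
odd-⌊n/2⌋ 0 (inj₁ ())
odd-⌊n/2⌋ 0 (inj₂ ())
odd-⌊n/2⌋ 1 (inj₁ ())
odd-⌊n/2⌋ 1 (inj₂ ())
odd-⌊n/2⌋ 2 e = refl
odd-⌊n/2⌋ 3 e = refl
odd-⌊n/2⌋ (suc (suc (suc (suc n)))) e = trans (not-involutive _) (odd-⌊n/2⌋ n (subst (λ k → k ≡ 2 ⊎ k ≡ 3) (trans (cong (_% 4) (+-comm 4 n)) ([m+n]%n≡m%n n 4)) e))

I≡0 : ∀ {n} → (n % 4 ≡ 2 ⊎ n % 4 ≡ 3) → (sh : Shape n) → odd (black (parts sh)) ≡ false → I sh ≡ + 0
I≡0 {n} n%4 sh even = trans (Σℤ-filter (isStandard (parts sh)) (perms (oneTo n)))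
  (Σ-standard≡0 (parts sh) (Partition.positive p) (Partition.total p)
    λ e → contradiction (trans (sym (odd-⌊n/2⌋ n n%4)) (trans (cong odd (sym e)) even)) λ ())
  where p = isPartition sh

-- Sums over an involution

module _ {c ℓ : Level} (R : CommutativeRing c ℓ) where
  open CommutativeRing R
    using (Carrier; _≈_; 0#; 1#; isEquivalence; ring; -‿cong)
    renaming (refl to ≈-refl; sym to ≈-sym; trans to ≈-trans; setoid to ≈-setoid; _+_ to _⊕_; -_ to ⊖_;
              +-identityˡ to ⊕-identityˡ; +-cong to ⊕-cong; +-assoc to ⊕-assoc; +-isCommutativeMonoid to ⊕-isCommutativeMonoid)
  open import Algebra.Properties.Ring ring using (-‿involutive)
  import Relation.Binary.Reasoning.Setoid ≈-setoid as ≈R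

  sumR-↭ : ∀ {A : Set} (g : A → Carrier) {xs ys} → xs ↭ ys → sumR R (map g xs) ≈ sumR R (map g ys)
  sumR-↭ g p = foldr-commMonoid ≈-setoid ⊕-isCommutativeMonoid (↭⇒↭ₛ′ isEquivalence (↭.map⁺ g p))

  module _ {A : Set} (g : A → Carrier) (φ : A → A) (φ-involutive : ∀ x → φ (φ x) ≡ x)
           (g-fixed : ∀ x → φ x ≡ x → g x ≈ 0#) (g-anti : ∀ x → g x ⊕ g (φ x) ≈ 0#) where

    -- Each `x` is removed together with `φ x`, or alone if fixed. At a fixed point `g-anti` says
    -- only that twice the value is 0, whence `g-fixed`. The recursion is on the bound `k`, since
    -- the list without `φ x` is not a subterm.
    sum-involution : ∀ k (xs : List A) → length xs ≤ k → Unique xs → (∀ {x} → x ∈ xs → φ x ∈ xs) →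
                     sumR R (map g xs) ≈ 0#
    sum-involution k [] le u closed = ≈-refl
    sum-involution (suc k) (x ∷ xs) (s≤s le) (x∉xs ∷ u) closed with closed (here refl)
    ... | here φx≡x = ≈-trans (⊕-cong (g-fixed x φx≡x) (sum-involution k xs le u closed')) (⊕-identityˡ 0#)
      where
      closed' : ∀ {y} → y ∈ xs → φ y ∈ xs
      closed' {y} y∈ with closed (there y∈)
      ... | there p = p
      ... | here φy≡x = contradiction (trans (sym φx≡x) (trans (cong φ (sym φy≡x)) (φ-involutive y))) (All.lookup x∉xs y∈)
    ... | there φx∈xs with ∈-∃++ φx∈xs
    ...   | as , bs , refl = begin
      g x ⊕ sumR R (map g (as ++ φ x ∷ bs))     ≈⟨ ⊕-cong ≈-refl (sumR-↭ g perm) ⟩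
      g x ⊕ (g (φ x) ⊕ sumR R (map g ys))       ≈⟨ ⊕-assoc (g x) (g (φ x)) _ ⟨
      g x ⊕ g (φ x) ⊕ sumR R (map g ys)         ≈⟨ ⊕-cong (g-anti x) (sum-involution k ys shorter (AllPairs.tail u') closed') ⟩
      0# ⊕ 0#                                   ≈⟨ ⊕-identityˡ 0# ⟩
      0#                                        ∎
      where
      open ≈R
      ys = as ++ bs
      perm : as ++ φ x ∷ bs ↭ φ x ∷ ys
      perm = ↭.shift (φ x) as bs
      u' : Unique (φ x ∷ ys)
      u' = Unique-resp-↭ (setoid A) (↭⇒↭ₛ perm) u
      shorter : length ys ≤ k
      shorter = ≤-trans (n≤1+n _) (≤-trans (≤-reflexive (sym (↭.↭-length perm))) le)
      closed' : ∀ {y} → y ∈ ys → φ y ∈ ys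
      closed' {y} y∈ with closed (there (↭.∈-resp-↭ (↭-sym perm) (there y∈)))
      -- The partner of `y` is not `x`, since `φ x` has been removed; nor is it `φ x`, since `x` has
      -- been removed.
      ... | here φy≡x = contradiction (trans (cong φ (sym φy≡x)) (φ-involutive y)) (All.lookup (AllPairs.head u') y∈)
      ... | there p with ↭.∈-resp-↭ perm p
      ...   | there q = q
      ...   | here φy≡φx = contradiction (trans (sym (φ-involutive x)) (trans (cong φ (sym φy≡φx)) (φ-involutive y)))
                             (All.lookup x∉xs (↭.∈-resp-↭ (↭-sym perm) (there y∈)))

  signR-odd : ∀ k → signR R k ≈ (if odd k then ⊖ 1# else 1#)
  signR-odd zero = ≈-refl
  signR-odd (suc k) with odd k | signR-odd k
  ... | true  | e = ≈-trans (-‿cong e) (-‿involutive 1#)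
  ... | false | e = -‿cong e

  signR-opposite : ∀ j k → odd j xor odd k ≡ true → signR R j ≈ ⊖ signR R k
  -- At `suc k`, `signR-odd` evaluates the negative of `signR R k`.
  signR-opposite j k e with odd j | odd k | signR-odd j | signR-odd (suc k)
  ... | true  | false | p | q = ≈-trans p (≈-sym q)
  ... | false | true  | p | q = ≈-trans p (≈-sym q)

-- The complex numbers are generalised to any commutative ring, and the sum over all shapes is taken
-- along an arbitrary complete list without repetitions.
theorem3p5 : {c ℓ : Level} (R : CommutativeRing c ℓ) → let open CommutativeRing R in
    (n : ℕ) → (n % 4 ≡ 2 ⊎ n % 4 ≡ 3) →
    (F : Shape n → Carrier) →
    (∀ (sh sh' : Shape n) → parts sh' ≡ conjParts (parts sh) → F sh ≈ F sh') →
    (∀ (sh : Shape n) → I sh ≡ + 0 → F sh ≈ 0#) →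
    (v : Shape n → ℕ) → (∀ (sh : Shape n) → IsMaxVertDominoes sh (v sh)) →
    (shapes : List (Shape n)) → (∀ (sh : Shape n) → sh ∈ shapes) → Unique shapes →
    sumR R (map (λ sh → signR R (v sh) * F sh) shapes) ≈ 0#
theorem3p5 R n n%4 F F-conj F-zero v vmax shapes complete unique =
  sum-involution R term conj conj-involutive fixed cancel (length shapes) shapes ≤-refl unique (λ _ → complete _)
  where
  open CommutativeRing R
    renaming (refl to ≈-refl; sym to ≈-sym; trans to ≈-trans; +-cong to ⊕-cong; +-identityˡ to ⊕-identityˡ; *-cong to ⊛-cong; _+_ to _⊕_)
  open import Algebra.Properties.Ring ring using (-‿distribˡ-*)
  term : Shape n → Carrier
  term sh = signR R (v sh) * F sh
  parity = odd-v-xor-odd-v-conj v vmax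
  even⇒F≈0 : ∀ sh → odd (black (parts sh)) ≡ false → F sh ≈ 0#
  even⇒F≈0 sh even = F-zero sh (I≡0 n%4 sh even)
  term-zero : ∀ sh → F sh ≈ 0# → term sh ≈ 0#
  term-zero sh Fsh≈0 = ≈-trans (⊛-cong ≈-refl Fsh≈0) (zeroʳ _)
  fixed : ∀ sh → conj sh ≡ sh → term sh ≈ 0#
  -- A self-conjugate shape has an even number of black cells, so its term vanishes through `F`.
  fixed sh e = term-zero sh (even⇒F≈0 sh (trans (sym (parity sh))
    (trans (cong (λ s → odd (v sh) xor odd (v s)) e) (xor-same (odd (v sh))))))
  cancel : ∀ sh → term sh ⊕ term (conj sh) ≈ 0#
  cancel sh with odd (black (parts sh)) in eq
  ... | false = ≈-trans (⊕-cong (term-zero sh F≈0) (term-zero (conj sh) (≈-trans (≈-sym (F-conj sh (conj sh) refl)) F≈0)))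
                        (⊕-identityˡ 0#)
    where F≈0 = even⇒F≈0 sh eq
  ... | true = ≈-trans
    (⊕-cong (≈-trans (⊛-cong (signR-opposite R (v sh) (v (conj sh)) (trans (parity sh) eq)) (F-conj sh (conj sh) refl))
                     (≈-sym (-‿distribˡ-* _ _))) ≈-refl)
    (-‿inverseˡ _)
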